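{- Let $n\ge 8$. Then the set $\{\eta(\Gamma(G)) : \Gamma(G) \text{ a signed graph whose underlying graph } G \text{ is a bicyclic graph on } n \text{ vertices}\}$ equals $\{0,1,2,\ldots,n-4\}$.
   Context: A signed graph $\Gamma(G)=(G,\sigma)$ consists of a simple graph $G$ and a map $\sigma:E(G)\to\{+,-\}$ (an arbitrary sign assignment, all-positive allowed); its adjacency matrix has entry $\sigma(v_iv_j)$ for edges and $0$ otherwise, and $\eta(\Gamma(G))$ is the multiplicity of $0$ as an eigenvalue. A bicyclic graph is a connected simple graph with $|E|=|V|+1$. -}

module Defs where

open import Data.Bool using (Bool; true; false; if_then_else_; _∧_)
open import Data.Nat using (ℕ; zero; suc; _<ᵇ_)
open import Data.Fin using (Fin; zero; suc; toℕ; punchIn)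
open import Data.Fin.Properties using () renaming (_≟_ to _≟ᶠ_)
open import Data.List using (List; []; _∷_; map; allFin; foldr)
open import Data.Nat.ListAction using (sum)
open import Data.Integer using (ℤ; 0ℤ; 1ℤ; -1ℤ) renaming (_+_ to _+ℤ_; _*_ to _*ℤ_; -_ to -ℤ_)
open import Data.Integer.Properties using () renaming (_≟_ to _≟ℤ_)
open import Data.Sign using (Sign)
open import Relation.Nullary using (does)
open import Relation.Binary.PropositionalEquality using (_≡_)

record Graph (n : ℕ) : Set where
  field
    adj    : Fin n → Fin n → Bool
    sym    : ∀ i j → adj i j ≡ adj j i
    irrefl : ∀ i → adj i i ≡ false
open Graph public

edgeCount : ∀ {n} → Graph n → ℕ
edgeCount {n} G =
  sum (map (λ i → sum (map (λ j → if adj G i j ∧ (toℕ i <ᵇ toℕ j) then 1 else 0)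
                           (allFin n)))
           (allFin n))

data Walk {n : ℕ} (G : Graph n) : Fin n → Fin n → Set where
  here : ∀ {i} → Walk G i i
  step : ∀ {i j k} → adj G i j ≡ true → Walk G j k → Walk G i k

Connected : ∀ {n} → Graph n → Set
Connected {n} G = ∀ (i j : Fin n) → Walk G i j

Bicyclic : ∀ {n} → Graph n → Set
Bicyclic {n} G = Connected G × (edgeCount G ≡ suc n)
  where open import Data.Product using (_×_)

-- Signatures: σ assigns a sign to each edge (stored symmetrically on
-- ordered pairs; values on non-edges are irrelevant).

record Signature {n : ℕ} (G : Graph n) : Set where
  field
    σ    : Fin n → Fin n → Sign
    σsym : ∀ i j → σ i j ≡ σ j i
open Signature public

signℤ : Sign → ℤ
signℤ Sign.+ = 1ℤ
signℤ Sign.- = -1ℤ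

adjMatrix : ∀ {n} (G : Graph n) → Signature G → Fin n → Fin n → ℤ
adjMatrix G s i j = if adj G i j then signℤ (σ s i j) else 0ℤ

-- Integer polynomials as coefficient lists, lowest degree first

Poly : Set
Poly = List ℤ

_⊕_ : Poly → Poly → Poly
[] ⊕ q = q
(a ∷ p) ⊕ [] = a ∷ p
(a ∷ p) ⊕ (b ∷ q) = (a +ℤ b) ∷ (p ⊕ q)

scale : ℤ → Poly → Poly
scale c = map (c *ℤ_)

_⊗_ : Poly → Poly → Poly
[] ⊗ q = []
(a ∷ p) ⊗ q = scale a q ⊕ (0ℤ ∷ (p ⊗ q))

constP : ℤ → Poly
constP c = c ∷ []

X : Poly
X = 0ℤ ∷ 1ℤ ∷ []

sumP : List Poly → Poly
sumP = foldr _⊕_ []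

det : ∀ n → (Fin n → Fin n → Poly) → Poly
det zero M = constP 1ℤ
det (suc n) M = sumP (map term (allFin (suc n)))
  where
    altSign : ℕ → ℤ
    altSign zero = 1ℤ
    altSign (suc zero) = -1ℤ
    altSign (suc (suc k)) = altSign k
    term : Fin (suc n) → Poly
    term j = scale (altSign (toℕ j))
               (M zero j ⊗ det n (λ r c → M (suc r) (punchIn j c)))

charPoly : ∀ n → (Fin n → Fin n → ℤ) → Poly
charPoly n A = det n (λ i j → (if does (i ≟ᶠ j) then X else []) ⊕ constP (-ℤ A i j))

mult0 : Poly → ℕ
mult0 [] = 0
mult0 (c ∷ cs) = if does (c ≟ℤ 0ℤ) then suc (mult0 cs) else 0

-- nullity η(Γ(G)) : multiplicity of the eigenvalue 0 of A(Γ(G))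
η : ∀ {n} (G : Graph n) → Signature G → ℕ
η {n} G s = mult0 (charPoly n (adjMatrix G s))

{-# OPTIONS --safe #-}

-- Upper bound: the coefficient of x^(n-4) in det (x I - A) is the sum of the principal minors
-- of order 4.  For a hollow symmetric matrix such a minor is
-- p² + q² + r² - 2 (p q + p r + q r), where p, q, r are the products of entries over the three
-- perfect matchings of the four vertices.  A connected graph with n + 1 edges has at most m + 1
-- edges on any m vertices, since every further vertex brings an edge.  Hence it contains no K₄,
-- so one of p, q, r vanishes and the minor is a square.  Some minor is 1: otherwise any two
-- disjoint edges are opposite sides of a 4-cycle, which forces K₂,₃ and then, if n ≥ 6, eight
-- edges on six vertices.
--
-- Existence: write F and H for the characteristic polynomials of a rooted graph and of the
-- graph without its root.  A pendant vertex at the root turns (F, H) into (x F - H, x H), and a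
-- pendant path with two edges turns it into (x² F - x H - F, x² H - H).  Starting from a small
-- nonsingular core, pendant paths add 2 to n and keep the nullity, and pendant vertices add 1
-- to both.  Two cores provide the two parities of n - k.

module Submission where

open import Defs renaming (sym to adj-sym)
open import Data.Nat using (ℕ; _≤_; _∸_)
open import Data.Product using (Σ; _×_)
open import Relation.Binary.PropositionalEquality using (_≡_)
open import Function.Bundles using (_⇔_)

open import Data.Bool using (Bool; true; false; if_then_else_; _∧_; not; T)
open import Data.Bool.Properties using (¬-not; ∧-zeroʳ) renaming (_≟_ to _≟ᵇ_)
open import Data.Empty using (⊥; ⊥-elim)
open import Data.Fin using (Fin; zero; suc; toℕ; punchIn; punchOut; inject₁; fromℕ<)
import Data.Fin as Fin
open import Data.Fin.Patterns using (0F; 1F; 2F; 3F)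
open import Data.Fin.Properties
  using (punchIn-punchOut; punchIn-injective; toℕ-inject₁; toℕ<n; toℕ-fromℕ<; toℕ-injective;
         all?; any?; <-cmp)
  renaming (_≟_ to _≟ᶠ_)
open import Data.Integer
  using (ℤ; 0ℤ; 1ℤ; -1ℤ; +0; +[1+_]; -[1+_]; _+_; _*_; -_; _-_; +<+; -<+; +≤+)
import Data.Integer as ℤ
import Data.Integer.Properties as ℤₚ
open import Data.Integer.Properties
  using (+-identityˡ; +-identityʳ; *-zeroˡ; *-zeroʳ; *-identityˡ; *-assoc; +-*-semiring)
  renaming (_≟_ to _≟ℤ_)
open import Data.Integer.Tactic.RingSolver using (solve-∀)
open import Data.List
  using (List; []; _∷_; [_]; _++_; map; filter; cartesianProduct; allFin; tabulate; length)
import Data.List.Membership.DecPropositional as DecMembership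
open import Data.List.Membership.Propositional using (_∈_; _∉_)
open import Data.List.Membership.Propositional.Properties
  using (∈-∃++; ∈-++⁻; ∈-++⁺ˡ; ∈-++⁺ʳ; ∈-allFin; ∈-filter⁺; ∈-filter⁻; ∈-cartesianProduct⁺;
         ∈-map⁺; ∈-map⁻)
open import Data.List.Properties
  using (map-cong; map-tabulate; map-++; map-∘; length-map; length-++; length-++-sucʳ;
         length-tabulate)
open import Data.List.Relation.Binary.Subset.Propositional using (_⊆_)
open import Data.List.Relation.Unary.All using (All; []; _∷_)
import Data.List.Relation.Unary.All as All
open import Data.List.Relation.Unary.All.Properties using (¬Any⇒All¬)
open import Data.List.Relation.Unary.AllPairs using ([]; _∷_)
open import Data.List.Relation.Unary.Any using (here; there)
open import Data.List.Relation.Unary.Unique.DecPropositional using (unique?)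
open import Data.List.Relation.Unary.Unique.Propositional using (Unique)
import Data.List.Relation.Unary.Unique.Propositional.Properties as Unique
open import Data.Nat using (zero; suc; _<_; _<?_; _<ᵇ_; z≤n; s≤s)
import Data.Nat as ℕ
open import Data.Nat.ListAction using () renaming (sum to sumℕ)
open import Data.Nat.ListAction.Properties using (sum-++)
import Data.Nat.Properties as ℕₚ
open import Data.Nat.Tactic.RingSolver using () renaming (solve-∀ to ℕ-solve-∀)
open import Data.Product using (∃; _,_; proj₁; proj₂)
open import Data.Sign using (Sign)
open import Data.Sign.Properties using () renaming (_≟_ to _≟ˢ_)
open import Data.Sum using (_⊎_; inj₁; inj₂)
open import Data.Unit using (tt)
open import Function using (_∘_; case_of_; mk⇔)
open import Algebra.Properties.Semiring.Sum +-*-semiring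
  using (sum; sum-cong-≗; sum-remove; ∑-distrib-+; *-distribˡ-sum; sum-replicate-zero)
open import Relation.Binary.Definitions using (tri<; tri≈; tri>)
open import Relation.Binary.PropositionalEquality
  using (_≢_; refl; sym; ≢-sym; trans; cong; cong₂; subst; module ≡-Reasoning)
open import Relation.Nullary using (Dec; ¬_; ¬?; does; yes; no; contradiction)
open import Relation.Nullary.Decidable using (from-yes; decidable-stable; _×-dec_; _⊎-dec_)

open ≡-Reasoning

Matrix : ℕ → Set
Matrix n = Fin n → Fin n → ℤ

-- Coefficients of determinants of matrix pencils

-- Coefficient lists may end in zeros, so polynomials are compared coefficient by coefficient; past
-- the end of a list the value is 0.
coeff : Poly → ℕ → ℤ
coeff []      _       = 0ℤ
coeff (a ∷ _) zero    = a
coeff (_ ∷ p) (suc k) = coeff p k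

shift : (ℕ → ℤ) → ℕ → ℤ
shift f zero    = 0ℤ
shift f (suc k) = f k

alt : ℕ → ℤ
alt zero          = 1ℤ
alt (suc zero)    = -1ℤ
alt (suc (suc k)) = alt k

alt-suc : ∀ k → alt (suc k) ≡ - alt k
alt-suc zero          = refl
alt-suc (suc zero)    = refl
alt-suc (suc (suc k)) = alt-suc k

alt-square : ∀ k → alt k * alt k ≡ 1ℤ
alt-square zero          = refl
alt-square (suc zero)    = refl
alt-square (suc (suc k)) = alt-square k

minor : ∀ {n} → Fin (suc n) → Fin (suc n) → Matrix (suc n) → Matrix n
minor r c A i j = A (punchIn r i) (punchIn c j)

-- (a + x b) · f, for a power series f
linear : ℤ → ℤ → (ℕ → ℤ) → ℕ → ℤ
linear a b f k = a * f k + b * shift f k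

-- pencil n A B k is the coefficient of x^k in det (A + x B).
pencil : ∀ n → Matrix n → Matrix n → ℕ → ℤ
pencil zero    A B zero    = 1ℤ
pencil zero    A B (suc k) = 0ℤ
pencil (suc n) A B k = sum λ j →
  alt (toℕ j) * linear (A zero j) (B zero j) (pencil n (minor zero j A) (minor zero j B)) k

coeff-⊕ : ∀ p q k → coeff (p ⊕ q) k ≡ coeff p k + coeff q k
coeff-⊕ []      q       k       = sym (+-identityˡ _)
coeff-⊕ (a ∷ p) []      k       = sym (+-identityʳ _)
coeff-⊕ (a ∷ p) (b ∷ q) zero    = refl
coeff-⊕ (a ∷ p) (b ∷ q) (suc k) = coeff-⊕ p q k

coeff-scale : ∀ c p k → coeff (scale c p) k ≡ c * coeff p k
coeff-scale c []      k       = sym (*-zeroʳ c)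
coeff-scale c (a ∷ p) zero    = refl
coeff-scale c (a ∷ p) (suc k) = coeff-scale c p k

coeff-shift : ∀ p k → coeff (0ℤ ∷ p) k ≡ shift (coeff p) k
coeff-shift p zero    = refl
coeff-shift p (suc k) = refl

coeff-0∷ : ∀ {p} → (∀ k → coeff p k ≡ 0ℤ) → ∀ k → coeff (0ℤ ∷ p) k ≡ 0ℤ
coeff-0∷ p≡0 zero    = refl
coeff-0∷ p≡0 (suc k) = p≡0 k

indicator : Bool → ℤ
indicator b = if b then 1ℤ else 0ℤ

-- The shape of an entry in `charPoly`: `b` tells whether the entry lies on the diagonal.
linearP : Bool → ℤ → Poly
linearP b a = (if b then X else []) ⊕ constP a

shift-cong : ∀ {f g} → (∀ k → f k ≡ g k) → ∀ k → shift f k ≡ shift g k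
shift-cong f≡g zero    = refl
shift-cong f≡g (suc k) = f≡g k

coeff-⊗ : ∀ b a q k → coeff (linearP b a ⊗ q) k ≡ linear a (indicator b) (coeff q) k
coeff-⊗ false a q k = begin
  coeff (scale a q ⊕ (0ℤ ∷ [])) k            ≡⟨ coeff-⊕ (scale a q) _ k ⟩
  coeff (scale a q) k + coeff (0ℤ ∷ []) k    ≡⟨ cong₂ _+_ (coeff-scale a q k) (coeff-0∷ (λ _ → refl) k) ⟩
  a * coeff q k + 0ℤ                         ≡⟨ cong (a * coeff q k +_) (*-zeroˡ (shift (coeff q) k)) ⟨
  a * coeff q k + 0ℤ * shift (coeff q) k     ∎
coeff-⊗ true a q k = begin
  coeff (scale (0ℤ + a) q ⊕ (0ℤ ∷ xq)) k
    ≡⟨ coeff-⊕ (scale (0ℤ + a) q) _ k ⟩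
  coeff (scale (0ℤ + a) q) k + coeff (0ℤ ∷ xq) k
    ≡⟨ cong₂ _+_ (coeff-scale (0ℤ + a) q k) (trans (coeff-shift xq k) (shift-cong xq≡q k)) ⟩
  (0ℤ + a) * coeff q k + shift (coeff q) k
    ≡⟨ cong₂ (λ u v → u * coeff q k + v) (+-identityˡ a) (sym (*-identityˡ _)) ⟩
  a * coeff q k + 1ℤ * shift (coeff q) k ∎
  where
  xq = scale 1ℤ q ⊕ (0ℤ ∷ [])
  xq≡q : ∀ i → coeff xq i ≡ coeff q i
  xq≡q i = begin
    coeff xq i                                ≡⟨ coeff-⊕ (scale 1ℤ q) _ i ⟩
    coeff (scale 1ℤ q) i + coeff (0ℤ ∷ []) i  ≡⟨ cong₂ _+_ (coeff-scale 1ℤ q i) (coeff-0∷ (λ _ → refl) i) ⟩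
    1ℤ * coeff q i + 0ℤ                       ≡⟨ trans (+-identityʳ _) (*-identityˡ _) ⟩
    coeff q i                                 ∎

coeff-sumP-map : ∀ {A : Set} {n} (t : A → Poly) (f : Fin n → A) k →
  coeff (sumP (map t (tabulate f))) k ≡ sum (λ j → coeff (t (f j)) k)
coeff-sumP-map {n = zero}  t f k = refl
coeff-sumP-map {n = suc n} t f k =
  trans (coeff-⊕ (t (f zero)) _ k) (cong (coeff (t (f zero)) k +_) (coeff-sumP-map t (f ∘ suc) k))

linear-cong : ∀ a b {f g} → (∀ k → f k ≡ g k) → ∀ k → linear a b f k ≡ linear a b g k
linear-cong a b f≡g k = cong₂ (λ u v → a * u + b * v) (f≡g k) (shift-cong f≡g k)

-- The terms and the signs in det are local to its definition, so they are recovered by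
-- unification.
detTerms : ∀ n (M : Fin (suc n) → Fin (suc n) → Poly) →
  Σ (Fin (suc n) → Poly) λ t → det (suc n) M ≡
    scale 1ℤ (M zero zero ⊗ det n (λ r c → M (suc r) (suc c))) ⊕ sumP (map t (tabulate suc))
detTerms n M = _ , refl

detSigns : ∀ n (M : Fin (suc n) → Fin (suc n) → Poly) →
  Σ (Fin (suc n) → ℤ → ℤ) λ s → ∀ j → proj₁ (detTerms n M) j ≡
    map (s j) (M zero j ⊗ det n (λ r c → M (suc r) (punchIn j c)))
detSigns n M = _ , λ _ → refl

-- The hidden signs have period 2, so the index is lowered by two within the same `Fin`. The
-- recursion runs on `i`, because the lowered index is not a subterm of `j`.
detSigns-alt : ∀ n M i j → toℕ j ≡ i → ∀ y → proj₁ (detSigns n M) j y ≡ alt i * y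
detSigns-alt n M zero          zero          _  y = refl
detSigns-alt n M (suc zero)    (suc zero)    _  y = refl
detSigns-alt (suc n) M (suc (suc i)) (suc (suc j)) eq y = trans two-step (detSigns-alt (suc n) M i j′ j′≡i y)
  where
  j′ = inject₁ (inject₁ j)
  j′≡j : toℕ j′ ≡ toℕ j
  j′≡j = trans (toℕ-inject₁ (inject₁ j)) (toℕ-inject₁ j)
  j′≡i : toℕ j′ ≡ i
  j′≡i = trans j′≡j (ℕₚ.suc-injective (ℕₚ.suc-injective eq))
  two-step : proj₁ (detSigns (suc n) M) (suc (suc j)) y ≡ proj₁ (detSigns (suc n) M) j′ y
  two-step rewrite sym j′≡j = refl

coeff-det-suc : ∀ n M k → coeff (det (suc n) M) k ≡
  sum (λ j → alt (toℕ j) * coeff (M zero j ⊗ det n (λ r c → M (suc r) (punchIn j c))) k)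
coeff-det-suc n M k = begin
  coeff (det (suc n) M) k                                      ≡⟨ cong (λ p → coeff p k) (proj₂ (detTerms n M)) ⟩
  coeff (t₀ ⊕ sumP (map t (tabulate suc))) k                   ≡⟨ coeff-⊕ t₀ _ k ⟩
  coeff t₀ k + coeff (sumP (map t (tabulate suc))) k
    ≡⟨ cong₂ _+_ (coeff-scale 1ℤ e₀ k) (coeff-sumP-map t suc k) ⟩
  1ℤ * coeff e₀ k + sum (λ j → coeff (t (suc j)) k)
    ≡⟨ cong (1ℤ * coeff e₀ k +_) (sum-cong-≗ λ j →
         trans (cong (λ p → coeff p k) (t≡ (suc j))) (coeff-scale (alt (toℕ (suc j))) (e (suc j)) k)) ⟩
  sum (λ j → alt (toℕ j) * coeff (e j) k) ∎
  where
  t  = proj₁ (detTerms n M)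
  e  = λ j → M zero j ⊗ det n (λ r c → M (suc r) (punchIn j c))
  e₀ = e zero
  t₀ = scale 1ℤ e₀
  t≡ : ∀ j → t j ≡ scale (alt (toℕ j)) (e j)
  t≡ j = trans (proj₂ (detSigns n M) j) (map-cong (detSigns-alt n M (toℕ j) j refl) (e j))

coeff-det : ∀ n (β : Fin n → Fin n → Bool) (A : Matrix n) k →
  coeff (det n (λ i j → linearP (β i j) (A i j))) k ≡ pencil n A (λ i j → indicator (β i j)) k
coeff-det zero    β A zero    = refl
coeff-det zero    β A (suc k) = refl
coeff-det (suc n) β A k =
  trans (coeff-det-suc n (λ i j → linearP (β i j) (A i j)) k) (sum-cong-≗ λ j →
    let ih = coeff-det n (λ r c → β (suc r) (punchIn j c)) (minor zero j A)
        q  = det n (λ r c → linearP (β (suc r) (punchIn j c)) (A (suc r) (punchIn j c)))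
    in cong (alt (toℕ j) *_)
         (trans (coeff-⊗ (β zero j) (A zero j) q k) (linear-cong (A zero j) (indicator (β zero j)) ih k)))

-- Expansion of pencils along a column and splitting along a row.

sum-zero : ∀ {n} (f : Fin n → ℤ) → (∀ j → f j ≡ 0ℤ) → sum f ≡ 0ℤ
sum-zero {n} f f≡0 = trans (sum-cong-≗ f≡0) (sum-replicate-zero n)

sum-single : ∀ {n} (c : Fin (suc n)) f → (∀ j → f (punchIn c j) ≡ 0ℤ) → sum f ≡ f c
sum-single c f f≡0 = begin
  sum f                             ≡⟨ sum-remove {i = c} f ⟩
  f c + sum (f ∘ punchIn c)         ≡⟨ cong (f c +_) (sum-zero _ f≡0) ⟩
  f c + 0ℤ                          ≡⟨ +-identityʳ (f c) ⟩
  f c                               ∎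

linear-vanish : ∀ a b {f} → (∀ k → f k ≡ 0ℤ) → ∀ k → linear a b f k ≡ 0ℤ
linear-vanish a b f≡0 k = trans (linear-cong a b f≡0 k) (trans (lem k) (zeros a b))
  where
  zeros : ∀ a b → a * 0ℤ + b * 0ℤ ≡ 0ℤ
  zeros = solve-∀
  lem : ∀ k → linear a b (λ _ → 0ℤ) k ≡ a * 0ℤ + b * 0ℤ
  lem zero    = refl
  lem (suc k) = refl

linear-scale : ∀ a b s f k → linear a b (λ i → s * f i) k ≡ s * linear a b f k
linear-scale a b s f zero    = lem a b s (f 0)
  where
  lem : ∀ a b s f → a * (s * f) + b * 0ℤ ≡ s * (a * f + b * 0ℤ)
  lem = solve-∀
linear-scale a b s f (suc k) = lem a b s (f (suc k)) (f k)
  where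
  lem : ∀ a b s f g → a * (s * f) + b * (s * g) ≡ s * (a * f + b * g)
  lem = solve-∀

linear-+-shift : ∀ a b s f g k →
  linear a b (λ i → f i + s * shift g i) k ≡ linear a b f k + s * shift (linear a b g) k
linear-+-shift a b s f g zero    = lem a b s (f 0)
  where
  lem : ∀ a b s f → a * (f + s * 0ℤ) + b * 0ℤ ≡ (a * f + b * 0ℤ) + s * 0ℤ
  lem = solve-∀
linear-+-shift a b s f g (suc k) = lem a b s (f (suc k)) (f k) (g k) (shift g k)
  where
  lem : ∀ a b s f₁ f₀ g₁ g₀ →
    a * (f₁ + s * g₁) + b * (f₀ + s * g₀) ≡ (a * f₁ + b * f₀) + s * (a * g₁ + b * g₀)
  lem = solve-∀

pencil-cong : ∀ n (A A′ B B′ : Matrix n) → (∀ i j → A i j ≡ A′ i j) → (∀ i j → B i j ≡ B′ i j) →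
  ∀ k → pencil n A B k ≡ pencil n A′ B′ k
pencil-cong zero    A A′ B B′ A≡ B≡ zero    = refl
pencil-cong zero    A A′ B B′ A≡ B≡ (suc k) = refl
pencil-cong (suc n) A A′ B B′ A≡ B≡ k = sum-cong-≗ λ j → cong (alt (toℕ j) *_)
  (trans (linear-cong (A zero j) (B zero j)
            (pencil-cong n (minor zero j A) (minor zero j A′) (minor zero j B) (minor zero j B′)
              (λ x y → A≡ (suc x) (punchIn j y)) (λ x y → B≡ (suc x) (punchIn j y))) k)
         (cong₂ (λ a b → linear a b (pencil n (minor zero j A′) (minor zero j B′)) k)
            (A≡ zero j) (B≡ zero j)))

pencil-zero-column : ∀ n (A B : Matrix (suc n)) →
  (∀ i → A i zero ≡ 0ℤ) → (∀ i → B i zero ≡ 0ℤ) → ∀ k → pencil (suc n) A B k ≡ 0ℤ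
pencil-zero-column n A B A≡0 B≡0 k = sum-zero _ λ j →
  trans (cong (alt (toℕ j) *_) (vanish n A B A≡0 B≡0 j)) (*-zeroʳ (alt (toℕ j)))
  where
  vanish : ∀ n (A B : Matrix (suc n)) → (∀ i → A i zero ≡ 0ℤ) → (∀ i → B i zero ≡ 0ℤ) → ∀ j →
    linear (A zero j) (B zero j) (pencil n (minor zero j A) (minor zero j B)) k ≡ 0ℤ
  vanish n A B A≡0 B≡0 zero =
    cong₂ (λ a b → linear a b (pencil n (minor zero zero A) (minor zero zero B)) k)
      (A≡0 zero) (B≡0 zero)
  vanish (suc n) A B A≡0 B≡0 (suc j) =
    linear-vanish (A zero (suc j)) (B zero (suc j))
      (pencil-zero-column n (minor zero (suc j) A) (minor zero (suc j) B) (A≡0 ∘ suc) (B≡0 ∘ suc)) k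

-- Induction on `r`: in the expansion along row zero the term of column zero vanishes, and in every
-- other minor column zero still has a single entry, one row higher. This row shift and the shift of
-- the column index produce the sign.
pencil-single-column : ∀ n r (A B : Matrix (suc n)) →
  (∀ i → A (punchIn r i) zero ≡ 0ℤ) → (∀ i → B i zero ≡ 0ℤ) → ∀ k →
  pencil (suc n) A B k ≡ alt (toℕ r) * (A r zero * pencil n (minor r zero A) (minor r zero B) k)
pencil-single-column n zero A B A≡0 B≡0 k = begin
  pencil (suc n) A B k                    ≡⟨ sum-single zero g (others n A B A≡0 B≡0) ⟩
  1ℤ * (A zero zero * P + B zero zero * Q) ≡⟨ cong (λ b → 1ℤ * (A zero zero * P + b * Q)) (B≡0 zero) ⟩
  1ℤ * (A zero zero * P + 0ℤ * Q)         ≡⟨ cong (1ℤ *_) (+-identityʳ (A zero zero * P)) ⟩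
  1ℤ * (A zero zero * P)                  ∎
  where
  g = λ j → alt (toℕ j) * linear (A zero j) (B zero j) (pencil n (minor zero j A) (minor zero j B)) k
  P = pencil n (minor zero zero A) (minor zero zero B) k
  Q = shift (pencil n (minor zero zero A) (minor zero zero B)) k
  others : ∀ n (A B : Matrix (suc n)) → (∀ i → A (suc i) zero ≡ 0ℤ) → (∀ i → B i zero ≡ 0ℤ) → ∀ j →
    alt (toℕ (suc j)) * linear (A zero (suc j)) (B zero (suc j))
      (pencil n (minor zero (suc j) A) (minor zero (suc j) B)) k ≡ 0ℤ
  others (suc n) A B A≡0 B≡0 j = trans
    (cong (alt (toℕ (suc j)) *_)
      (linear-vanish (A zero (suc j)) (B zero (suc j))
        (pencil-zero-column n (minor zero (suc j) A) (minor zero (suc j) B) A≡0 (B≡0 ∘ suc)) k))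
    (*-zeroʳ (alt (toℕ (suc j))))
pencil-single-column (suc n) (suc r) A B A≡0 B≡0 k = begin
  1ℤ * linear (A zero zero) (B zero zero) P₀ k + sum (λ j → alt (toℕ (suc j)) * linear (a j) (b j) (P j) k)
    ≡⟨ cong₂ _+_ (cong₂ (λ a b → 1ℤ * linear a b P₀ k) (A≡0 zero) (B≡0 zero))
                 (trans (sum-cong-≗ term) (sym (*-distribˡ-sum s (λ j → alt (toℕ j) * linear (a j) (b j) (R j) k)))) ⟩
  0ℤ + s * sum (λ j → alt (toℕ j) * linear (a j) (b j) (R j) k)
    ≡⟨ +-identityˡ _ ⟩
  s * sum (λ j → alt (toℕ j) * linear (a j) (b j) (R j) k)
    ≡⟨ *-assoc (alt (toℕ (suc r))) (A (suc r) zero) (sum (λ j → alt (toℕ j) * linear (a j) (b j) (R j) k)) ⟩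
  alt (toℕ (suc r)) * (A (suc r) zero * sum (λ j → alt (toℕ j) * linear (a j) (b j) (R j) k)) ∎
  where
  P₀ = pencil (suc n) (minor zero zero A) (minor zero zero B)
  a = λ j → A zero (suc j)
  b = λ j → B zero (suc j)
  P = λ j → pencil (suc n) (minor zero (suc j) A) (minor zero (suc j) B)
  R = λ j → pencil n (minor zero j (minor (suc r) zero A)) (minor zero j (minor (suc r) zero B))
  s = alt (toℕ (suc r)) * A (suc r) zero
  signs : ∀ u v x y → - u * (v * x * y) ≡ - v * x * (u * y)
  signs = solve-∀
  term : ∀ j → alt (toℕ (suc j)) * linear (a j) (b j) (P j) k ≡ s * (alt (toℕ j) * linear (a j) (b j) (R j) k)
  term j = begin
    alt (toℕ (suc j)) * linear (a j) (b j) (P j) k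
      ≡⟨ cong₂ _*_ (alt-suc (toℕ j)) (trans (linear-cong (a j) (b j) ih k) (linear-scale (a j) (b j) t (R j) k)) ⟩
    - alt (toℕ j) * (t * linear (a j) (b j) (R j) k)
      ≡⟨ signs (alt (toℕ j)) (alt (toℕ r)) (A (suc r) zero) (linear (a j) (b j) (R j) k) ⟩
    - alt (toℕ r) * A (suc r) zero * (alt (toℕ j) * linear (a j) (b j) (R j) k)
      ≡⟨ cong (λ u → u * A (suc r) zero * (alt (toℕ j) * linear (a j) (b j) (R j) k)) (alt-suc (toℕ r)) ⟨
    s * (alt (toℕ j) * linear (a j) (b j) (R j) k) ∎
    where
    t = alt (toℕ r) * A (suc r) zero
    ih : ∀ i → P j i ≡ t * R j i
    ih i = trans
      (pencil-single-column n r (minor zero (suc j) A) (minor zero (suc j) B) (A≡0 ∘ suc) (B≡0 ∘ suc) i)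
      (sym (*-assoc (alt (toℕ r)) (A (suc r) zero) (R j i)))

-- Deleting c and then i amounts to deleting punchIn c i and then pivot c i.
pivot : ∀ {m} → Fin (suc (suc m)) → Fin (suc m) → Fin (suc m)
pivot                 zero    i       = zero
pivot                 (suc c) zero    = c
pivot {m = suc m}     (suc c) (suc i) = suc (pivot c i)

punchIn-pivot : ∀ {m} (c : Fin (suc (suc m))) i → punchIn (punchIn c i) (pivot c i) ≡ c
punchIn-pivot             zero    i       = refl
punchIn-pivot             (suc c) zero    = refl
punchIn-pivot {m = suc m} (suc c) (suc i) = cong suc (punchIn-pivot c i)

punchIn-comm : ∀ {m} (c : Fin (suc (suc m))) i (y : Fin m) →
  punchIn (punchIn c i) (punchIn (pivot c i) y) ≡ punchIn c (punchIn i y)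
punchIn-comm             zero    i       y       = refl
punchIn-comm             (suc c) zero    y       = refl
punchIn-comm {m = suc m} (suc c) (suc i) zero    = refl
punchIn-comm {m = suc m} (suc c) (suc i) (suc y) = cong suc (punchIn-comm c i y)

-- Deleting the same two columns in the opposite order costs one transposition, hence the minus
-- sign.
alt-pivot : ∀ {m} (c : Fin (suc (suc m))) i →
  alt (toℕ (punchIn c i)) * alt (toℕ (pivot c i)) ≡ - (alt (toℕ c) * alt (toℕ i))
alt-pivot zero i = trans (cong (_* 1ℤ) (alt-suc (toℕ i))) (lem (alt (toℕ i)))
  where
  lem : ∀ u → - u * 1ℤ ≡ - (1ℤ * u)
  lem = solve-∀
alt-pivot (suc c) zero = trans (lem (alt (toℕ c))) (cong (λ u → - (u * 1ℤ)) (sym (alt-suc (toℕ c))))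
  where
  lem : ∀ u → 1ℤ * u ≡ - (- u * 1ℤ)
  lem = solve-∀
alt-pivot {m = suc m} (suc c) (suc i) = begin
  alt (suc p) * alt (suc q)                      ≡⟨ cong₂ _*_ (alt-suc p) (alt-suc q) ⟩
  - alt p * - alt q                              ≡⟨ lem (alt p) (alt q) ⟩
  alt p * alt q                                  ≡⟨ alt-pivot c i ⟩
  - (alt (toℕ c) * alt (toℕ i))                  ≡⟨ cong -_ (lem (alt (toℕ c)) (alt (toℕ i))) ⟨
  - (- alt (toℕ c) * - alt (toℕ i))              ≡⟨ cong -_ (cong₂ _*_ (alt-suc (toℕ c)) (alt-suc (toℕ i))) ⟨
  - (alt (toℕ (suc c)) * alt (toℕ (suc i)))      ∎
  where
  p = toℕ (punchIn c i)
  q = toℕ (pivot c i)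
  lem : ∀ u v → - u * - v ≡ u * v
  lem = solve-∀

punchIn-cover : ∀ {n} {P : Fin (suc n) → Set} r → P r → (∀ i → P (punchIn r i)) → ∀ i → P i
punchIn-cover {P = P} r Pr Pi i with r ≟ᶠ i
... | yes refl = Pr
... | no  r≢i  = subst P (punchIn-punchOut r≢i) (Pi (punchOut r≢i))

shift-sum : ∀ {n} (f : Fin n → ℕ → ℤ) k → shift (λ i → sum (λ j → f j i)) k ≡ sum (λ j → shift (f j) k)
shift-sum {n} f zero    = sym (sum-zero {n} (λ j → shift (f j) 0) (λ _ → refl))
shift-sum f (suc k) = refl

shift-scale : ∀ s f k → shift (λ i → s * f i) k ≡ s * shift f k
shift-scale s f zero    = sym (*-zeroʳ s)
shift-scale s f (suc k) = refl

-- The x-part of row r is the unit vector at c, so det splits by linearity in that row.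
pencil-split-row : ∀ n r c (A B B′ : Matrix (suc n)) →
  (∀ i j → B′ (punchIn r i) j ≡ B (punchIn r i) j) → (∀ j → B′ r j ≡ 0ℤ) →
  B r c ≡ 1ℤ → (∀ j → B r (punchIn c j) ≡ 0ℤ) → ∀ k →
  pencil (suc n) A B k ≡
  pencil (suc n) A B′ k + alt (toℕ r) * (alt (toℕ c) * shift (pencil n (minor r c A) (minor r c B)) k)
pencil-split-row n zero c A B B′ B′≡B B′≡0 B≡1 B≡0 k = begin
  pencil (suc n) A B k                       ≡⟨ sum-cong-≗ term ⟩
  sum (λ j → g′ j + e j)                     ≡⟨ ∑-distrib-+ g′ e ⟩
  sum g′ + sum e                             ≡⟨ cong (sum g′ +_) (sum-single c e e≡0) ⟩
  sum g′ + e c                               ≡⟨ cong (λ b → sum g′ + alt (toℕ c) * (b * shift (P c) k)) B≡1 ⟩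
  sum g′ + alt (toℕ c) * (1ℤ * shift (P c) k) ≡⟨ lem (sum g′) (alt (toℕ c)) (shift (P c) k) ⟩
  sum g′ + 1ℤ * (alt (toℕ c) * shift (P c) k) ∎
  where
  P  = λ j → pencil n (minor zero j A) (minor zero j B)
  P′ = λ j → pencil n (minor zero j A) (minor zero j B′)
  g′ = λ j → alt (toℕ j) * linear (A zero j) (B′ zero j) (P′ j) k
  e  = λ j → alt (toℕ j) * (B zero j * shift (P j) k)
  e≡0 : ∀ j → e (punchIn c j) ≡ 0ℤ
  e≡0 j = trans
    (cong (λ b → alt (toℕ (punchIn c j)) * (b * shift (P (punchIn c j)) k)) (B≡0 j))
    (*-zeroʳ (alt (toℕ (punchIn c j))))
  lem : ∀ g u v → g + u * (1ℤ * v) ≡ g + 1ℤ * (u * v)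
  lem = solve-∀
  split : ∀ u x y z → u * (x + y) ≡ u * (x + 0ℤ * z) + u * y
  split = solve-∀
  term : ∀ j → alt (toℕ j) * linear (A zero j) (B zero j) (P j) k ≡ g′ j + e j
  term j = trans
    (split (alt (toℕ j)) (A zero j * P j k) (B zero j * shift (P j) k) (shift (P′ j) k))
    (cong (_+ e j) (cong (alt (toℕ j) *_) (cong₂ (λ p b → A zero j * p + b * shift (P′ j) k)
      (pencil-cong n (minor zero j A) (minor zero j A) (minor zero j B) (minor zero j B′)
        (λ _ _ → refl) (λ x y → sym (B′≡B x (punchIn j y))) k)
      (sym (B′≡0 j)))))
pencil-split-row (suc n) (suc r) c A B B′ B′≡B B′≡0 B≡1 B≡0 k = begin
  sum g                                                 ≡⟨ sum-remove {i = c} g ⟩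
  g c + sum (g ∘ punchIn c)                             ≡⟨ cong₂ _+_ at-c (sum-cong-≗ off-c) ⟩
  g′ c + sum (λ i → g′ (punchIn c i) + s * e i)         ≡⟨ cong (g′ c +_) (∑-distrib-+ (g′ ∘ punchIn c) (λ i → s * e i)) ⟩
  g′ c + (sum (g′ ∘ punchIn c) + sum (λ i → s * e i))   ≡⟨ lem₁ (g′ c) (sum (g′ ∘ punchIn c)) (sum (λ i → s * e i)) ⟩
  (g′ c + sum (g′ ∘ punchIn c)) + sum (λ i → s * e i)   ≡⟨ cong₂ _+_ (sum-remove {i = c} g′) (*-distribˡ-sum s e) ⟨
  sum g′ + s * sum e                                    ≡⟨ cong (λ x → sum g′ + s * x) sum-e ⟩
  sum g′ + s * shift (pencil (suc n) (minor (suc r) c A) (minor (suc r) c B)) k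
    ≡⟨ cong (sum g′ +_) (*-assoc (alt (toℕ (suc r))) (alt (toℕ c))
                           (shift (pencil (suc n) (minor (suc r) c A) (minor (suc r) c B)) k)) ⟩
  sum g′ + alt (toℕ (suc r)) * (alt (toℕ c) * shift (pencil (suc n) (minor (suc r) c A) (minor (suc r) c B)) k) ∎
  where
  P  = λ j → pencil (suc n) (minor zero j A) (minor zero j B)
  P′ = λ j → pencil (suc n) (minor zero j A) (minor zero j B′)
  Q  = λ i → pencil n (minor zero i (minor (suc r) c A)) (minor zero i (minor (suc r) c B))
  g  = λ j → alt (toℕ j) * linear (A zero j) (B zero j) (P j) k
  g′ = λ j → alt (toℕ j) * linear (A zero j) (B′ zero j) (P′ j) k
  s  = alt (toℕ (suc r)) * alt (toℕ c)
  q  = λ i → linear (A zero (punchIn c i)) (B zero (punchIn c i)) (Q i)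
  e  = λ i → alt (toℕ i) * shift (q i) k
  lem₁ : ∀ x y z → x + (y + z) ≡ (x + y) + z
  lem₁ = solve-∀
  lem₂ : ∀ u l r p x → u * (l + r * p * x) ≡ u * l + r * (u * p) * x
  lem₂ = solve-∀
  lem₃ : ∀ r c i x → r * - (c * i) * x ≡ - r * c * (i * x)
  lem₃ = solve-∀
  sum-e : sum e ≡ shift (pencil (suc n) (minor (suc r) c A) (minor (suc r) c B)) k
  sum-e = sym (trans (shift-sum (λ i κ → alt (toℕ i) * q i κ) k)
                     (sum-cong-≗ λ i → shift-scale (alt (toℕ i)) (q i) k))
  -- Once column `c` is deleted, row `r` of `B` is zero as well, so `B` and `B′` have the same
  -- minor.
  at-c : g c ≡ g′ c
  at-c = cong (alt (toℕ c) *_) (trans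
    (linear-cong (A zero c) (B zero c)
      (pencil-cong (suc n) (minor zero c A) (minor zero c A) (minor zero c B) (minor zero c B′) (λ _ _ → refl)
        (punchIn-cover r (λ y → trans (B≡0 y) (sym (B′≡0 (punchIn c y))))
                         (λ i y → sym (B′≡B (suc i) (punchIn c y))))) k)
    (cong (λ b → linear (A zero c) b (P′ c) k) (sym (B′≡B zero c))))
  off-c : ∀ i → g (punchIn c i) ≡ g′ (punchIn c i) + s * e i
  off-c i = begin
    alt (toℕ j) * linear a b (P j) k
      ≡⟨ cong (alt (toℕ j) *_) (linear-cong a b ih k) ⟩
    alt (toℕ j) * linear a b (λ κ → P′ j κ + alt (toℕ r) * alt (toℕ p) * shift (Q i) κ) k
      ≡⟨ cong (alt (toℕ j) *_) (linear-+-shift a b (alt (toℕ r) * alt (toℕ p)) (P′ j) (Q i) k) ⟩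
    alt (toℕ j) * (linear a b (P′ j) k + alt (toℕ r) * alt (toℕ p) * shift (q i) k)
      ≡⟨ lem₂ (alt (toℕ j)) (linear a b (P′ j) k) (alt (toℕ r)) (alt (toℕ p)) (shift (q i) k) ⟩
    alt (toℕ j) * linear a b (P′ j) k + alt (toℕ r) * (alt (toℕ j) * alt (toℕ p)) * shift (q i) k
      ≡⟨ cong₂ _+_ (cong (λ b → alt (toℕ j) * linear a b (P′ j) k) (sym (B′≡B zero j)))
                   (cong (λ u → alt (toℕ r) * u * shift (q i) k) (alt-pivot c i)) ⟩
    g′ j + alt (toℕ r) * - (alt (toℕ c) * alt (toℕ i)) * shift (q i) k
      ≡⟨ cong (g′ j +_) (lem₃ (alt (toℕ r)) (alt (toℕ c)) (alt (toℕ i)) (shift (q i) k)) ⟩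
    g′ j + - alt (toℕ r) * alt (toℕ c) * e i
      ≡⟨ cong (λ u → g′ j + u * alt (toℕ c) * e i) (alt-suc (toℕ r)) ⟨
    g′ j + s * e i ∎
    where
    j = punchIn c i
    p = pivot c i
    a = A zero j
    b = B zero j
    -- Without column `j` the unit entry of row `r` sits at `pivot c i`, and the two orders of
    -- deleting both columns leave the same matrix.
    ih : ∀ κ → P j κ ≡ P′ j κ + alt (toℕ r) * alt (toℕ p) * shift (Q i) κ
    ih κ = trans
      (pencil-split-row n r p (minor zero j A) (minor zero j B) (minor zero j B′)
        (λ x y → B′≡B (suc x) (punchIn j y)) (λ y → B′≡0 (punchIn j y))
        (trans (cong (B (suc r)) (punchIn-pivot c i)) B≡1)
        (λ y → trans (cong (B (suc r)) (punchIn-comm c i y)) (B≡0 (punchIn i y))) κ)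
      (cong (P′ j κ +_) (trans
        (sym (*-assoc (alt (toℕ r)) (alt (toℕ p))
          (shift (pencil n (minor r p (minor zero j A)) (minor r p (minor zero j B))) κ)))
        (cong (alt (toℕ r) * alt (toℕ p) *_)
          (shift-cong (pencil-cong n (minor r p (minor zero j A)) (minor zero i (minor (suc r) c A))
                         (minor r p (minor zero j B)) (minor zero i (minor (suc r) c B))
            (λ x y → cong (A (suc (punchIn r x))) (punchIn-comm c i y))
            (λ x y → cong (B (suc (punchIn r x))) (punchIn-comm c i y))) κ))))

pencil-constant : ∀ n (A B : Matrix n) → (∀ i j → B i j ≡ 0ℤ) → ∀ k → pencil n A B (suc k) ≡ 0ℤ
pencil-constant zero    A B B≡0 k = refl
pencil-constant (suc n) A B B≡0 k = sum-zero _ λ j → begin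
  alt (toℕ j) * (A zero j * P j (suc k) + B zero j * P j k)
    ≡⟨ cong₂ (λ p b → alt (toℕ j) * (A zero j * p + b * P j k))
             (pencil-constant n (minor zero j A) (minor zero j B) (λ x y → B≡0 (suc x) (punchIn j y)) k) (B≡0 zero j) ⟩
  alt (toℕ j) * (A zero j * 0ℤ + 0ℤ * P j k)
    ≡⟨ lem (alt (toℕ j)) (A zero j) (P j k) ⟩
  0ℤ ∎
  where
  P = λ j → pencil n (minor zero j A) (minor zero j B)
  lem : ∀ u a p → u * (a * 0ℤ + 0ℤ * p) ≡ 0ℤ
  lem = solve-∀

-- Characteristic polynomials under isolated and pendant vertices.

identity : ∀ {n} → Matrix n
identity i j = indicator (does (i ≟ᶠ j))

identity-diagonal : ∀ {n} (r : Fin n) → identity r r ≡ 1ℤ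
identity-diagonal zero    = refl
identity-diagonal (suc r) = identity-diagonal r

identity-punchInʳ : ∀ {n} (r : Fin (suc n)) j → identity r (punchIn r j) ≡ 0ℤ
identity-punchInʳ         zero    j       = refl
identity-punchInʳ {suc n} (suc r) zero    = refl
identity-punchInʳ {suc n} (suc r) (suc j) = identity-punchInʳ r j

identity-punchIn : ∀ {n} (r : Fin (suc n)) i j → identity (punchIn r i) (punchIn r j) ≡ identity i j
identity-punchIn         zero    i       j       = refl
identity-punchIn {suc n} (suc r) zero    zero    = refl
identity-punchIn {suc n} (suc r) zero    (suc j) = refl
identity-punchIn {suc n} (suc r) (suc i) zero    = refl
identity-punchIn {suc n} (suc r) (suc i) (suc j) = identity-punchIn r i j

χ : ∀ {n} → Matrix n → ℕ → ℤ
χ {n} A = pencil n (λ i j → - A i j) identity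

coeff-charPoly : ∀ {n} (A : Matrix n) k → coeff (charPoly n A) k ≡ χ A k
coeff-charPoly {n} A = coeff-det n (λ i j → does (i ≟ᶠ j)) (λ i j → - A i j)

χ-cong : ∀ {n} {A A′ : Matrix n} → (∀ i j → A i j ≡ A′ i j) → ∀ k → χ A k ≡ χ A′ k
χ-cong {n} {A} {A′} A≡A′ = pencil-cong n (λ i j → - A i j) (λ i j → - A′ i j) identity identity
  (λ i j → cong -_ (A≡A′ i j)) (λ _ _ → refl)

isolate : ∀ {n} → Matrix n → Matrix (suc n)
isolate A zero    j       = 0ℤ
isolate A (suc i) zero    = 0ℤ
isolate A (suc i) (suc j) = A i j

-- The new vertex gets index zero; `identity c` serves as the indicator vector of its only
-- neighbour.
attach : ∀ {n} → Matrix n → Fin n → Matrix (suc n)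
attach A c zero    zero    = 0ℤ
attach A c zero    (suc j) = identity c j
attach A c (suc i) zero    = identity c i
attach A c (suc i) (suc j) = A i j

χ-isolate : ∀ {n} (A : Matrix n) k → χ (isolate A) k ≡ shift (χ A) k
χ-isolate {n} A k = begin
  χ (isolate A) k                                     ≡⟨ sum-single zero g others ⟩
  1ℤ * (0ℤ * χ A k + 1ℤ * shift (χ A) k)              ≡⟨ lem (χ A k) (shift (χ A) k) ⟩
  shift (χ A) k                                       ∎
  where
  M = λ i j → - isolate A i j
  g = λ j → alt (toℕ j) * linear (M zero j) (identity zero j) (pencil n (minor zero j M) (minor zero j identity)) k
  others : ∀ j → g (suc j) ≡ 0ℤ
  others j = *-zeroʳ (alt (toℕ (suc j)))
  lem : ∀ x y → 1ℤ * (0ℤ * x + 1ℤ * y) ≡ y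
  lem = solve-∀

-- Row zero has only x at zero and -1 at `suc c`. In the minor of the latter entry, column zero has
-- the single entry -1, in row `c`; expanding along it leaves the matrix without `c`, and the two
-- signs combine to -1.
χ-attach : ∀ {n} (A : Matrix (suc n)) c k → χ (attach A c) k ≡ shift (χ A) k - χ (minor c c A) k
χ-attach {n} A c k = begin
  g zero + sum (g ∘ suc)                        ≡⟨ cong (g zero +_) (sum-single c (g ∘ suc) others) ⟩
  1ℤ * (0ℤ * χ A k + 1ℤ * shift (χ A) k) + g (suc c)
    ≡⟨ cong (1ℤ * (0ℤ * χ A k + 1ℤ * shift (χ A) k) +_) at-c ⟩
  1ℤ * (0ℤ * χ A k + 1ℤ * shift (χ A) k) + - s * (-1ℤ * (s * (-1ℤ * H)) + 0ℤ * Q)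
    ≡⟨ lem (χ A k) (shift (χ A) k) s H Q ⟩
  shift (χ A) k - s * s * H                     ≡⟨ cong (λ u → shift (χ A) k - u * H) (alt-square (toℕ c)) ⟩
  shift (χ A) k - 1ℤ * H                        ≡⟨ cong (λ u → shift (χ A) k - u) (*-identityˡ H) ⟩
  shift (χ A) k - H                             ∎
  where
  M = λ i j → - attach A c i j
  P = λ j → pencil (suc n) (minor zero j M) (minor zero j identity)
  g = λ j → alt (toℕ j) * linear (M zero j) (identity zero j) (P j) k
  s = alt (toℕ c)
  H = χ (minor c c A) k
  Q = shift (P (suc c)) k
  others : ∀ j → g (suc (punchIn c j)) ≡ 0ℤ
  others j = trans (cong (λ u → alt (toℕ (suc (punchIn c j))) * linear (- u) 0ℤ (P (suc (punchIn c j))) k)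
                         (identity-punchInʳ c j))
                   (*-zeroʳ (alt (toℕ (suc (punchIn c j)))))
  P-c : P (suc c) k ≡ s * (-1ℤ * H)
  P-c = trans
    (pencil-single-column n c (minor zero (suc c) M) (minor zero (suc c) identity)
      (λ i → cong -_ (identity-punchInʳ c i)) (λ _ → refl) k)
    (cong₂ (λ u v → s * (- u * v)) (identity-diagonal c)
      (pencil-cong n (minor c zero (minor zero (suc c) M)) (λ i j → - minor c c A i j)
        (minor c zero (minor zero (suc c) identity)) identity
        (λ _ _ → refl) (identity-punchIn c) k))
  at-c : g (suc c) ≡ - s * (-1ℤ * (s * (-1ℤ * H)) + 0ℤ * Q)
  at-c = cong₂ _*_ (alt-suc (toℕ c)) (cong₂ (λ u v → - u * v + 0ℤ * Q) (identity-diagonal c) P-c)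
  lem : ∀ x y s h q → 1ℤ * (0ℤ * x + 1ℤ * y) + - s * (-1ℤ * (s * (-1ℤ * h)) + 0ℤ * q) ≡ y - s * s * h
  lem = solve-∀

mult0-≤ : ∀ p k → coeff p k ≢ 0ℤ → mult0 p ≤ k
mult0-≤ []      k       p≢0 = contradiction refl p≢0
mult0-≤ (a ∷ p) k       p≢0 with a ≟ℤ 0ℤ
mult0-≤ (a ∷ p) k       p≢0 | no  _   = z≤n
mult0-≤ (a ∷ p) zero    p≢0 | yes a≡0 = contradiction a≡0 p≢0
mult0-≤ (a ∷ p) (suc k) p≢0 | yes _   = s≤s (mult0-≤ p k p≢0)

mult0-≡ : ∀ p k → (∀ j → j < k → coeff p j ≡ 0ℤ) → coeff p k ≢ 0ℤ → mult0 p ≡ k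
mult0-≡ []      k       p≡0 p≢0 = contradiction refl p≢0
mult0-≡ (a ∷ p) k       p≡0 p≢0 with a ≟ℤ 0ℤ
mult0-≡ (a ∷ p) zero    p≡0 p≢0 | yes a≡0 = contradiction a≡0 p≢0
mult0-≡ (a ∷ p) (suc k) p≡0 p≢0 | yes _   = cong suc (mult0-≡ p k (λ j j<k → p≡0 (suc j) (s≤s j<k)) p≢0)
mult0-≡ (a ∷ p) zero    p≡0 p≢0 | no _    = refl
mult0-≡ (a ∷ p) (suc k) p≡0 p≢0 | no a≢0  = contradiction (p≡0 0 (s≤s z≤n)) a≢0

-- Signed bicyclic graphs of every nullity

Σℕ : ∀ n → (Fin n → ℕ) → ℕ
Σℕ n f = sumℕ (map f (allFin n))

Σℕ-suc : ∀ n f → Σℕ (suc n) f ≡ f zero ℕ.+ Σℕ n (f ∘ suc)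
Σℕ-suc n f = cong (λ xs → f zero ℕ.+ sumℕ xs)
  (trans (map-tabulate suc f) (sym (map-tabulate (λ i → i) (f ∘ suc))))

Σℕ-cong : ∀ n {f g : Fin n → ℕ} → (∀ i → f i ≡ g i) → Σℕ n f ≡ Σℕ n g
Σℕ-cong n f≡g = cong sumℕ (map-cong f≡g (allFin n))

Σℕ-zero : ∀ n → Σℕ n (λ _ → 0) ≡ 0
Σℕ-zero zero    = refl
Σℕ-zero (suc n) = trans (Σℕ-suc n (λ _ → 0)) (Σℕ-zero n)

-- The conjunct `true` is what `toℕ zero <ᵇ toℕ (suc j)` reduces to: this sum is the contribution of
-- a new pendant vertex to `edgeCount`.
Σℕ-identity : ∀ n (c : Fin n) → Σℕ n (λ j → if does (c ≟ᶠ j) ∧ true then 1 else 0) ≡ 1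
Σℕ-identity (suc n) zero    =
  trans (Σℕ-suc n (λ j → if does (zero ≟ᶠ j) ∧ true then 1 else 0)) (cong suc (Σℕ-zero n))
Σℕ-identity (suc n) (suc c) =
  trans (Σℕ-suc n (λ j → if does (suc c ≟ᶠ j) ∧ true then 1 else 0)) (Σℕ-identity n c)

edgeAt : ∀ {n} → Graph n → Fin n → Fin n → ℕ
edgeAt G i j = if adj G i j ∧ (toℕ i <ᵇ toℕ j) then 1 else 0

attachGraph : ∀ {n} → Graph n → Fin n → Graph (suc n)
attachGraph {n} G c = record { adj = adj′ ; sym = sym′ ; irrefl = irrefl′ }
  where
  adj′ : Fin (suc n) → Fin (suc n) → Bool
  adj′ zero    zero    = false
  adj′ zero    (suc j) = does (c ≟ᶠ j)
  adj′ (suc i) zero    = does (c ≟ᶠ i)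
  adj′ (suc i) (suc j) = adj G i j
  sym′ : ∀ i j → adj′ i j ≡ adj′ j i
  sym′ zero    zero    = refl
  sym′ zero    (suc j) = refl
  sym′ (suc i) zero    = refl
  sym′ (suc i) (suc j) = adj-sym G i j
  irrefl′ : ∀ i → adj′ i i ≡ false
  irrefl′ zero    = refl
  irrefl′ (suc i) = irrefl G i

attachSignature : ∀ {n} {G : Graph n} c → Signature G → Signature (attachGraph G c)
attachSignature {n} c s = record { σ = σ′ ; σsym = σsym′ }
  where
  σ′ : Fin (suc n) → Fin (suc n) → Sign
  σ′ (suc i) (suc j) = σ s i j
  σ′ _       _       = Sign.+
  σsym′ : ∀ i j → σ′ i j ≡ σ′ j i
  σsym′ zero    zero    = refl
  σsym′ zero    (suc j) = refl
  σsym′ (suc i) zero    = refl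
  σsym′ (suc i) (suc j) = σsym s i j

adjMatrix-attach : ∀ {n} (G : Graph n) s c i j →
  adjMatrix (attachGraph G c) (attachSignature c s) i j ≡ attach (adjMatrix G s) c i j
adjMatrix-attach G s c zero    zero    = refl
adjMatrix-attach G s c zero    (suc j) = refl
adjMatrix-attach G s c (suc i) zero    = refl
adjMatrix-attach G s c (suc i) (suc j) = refl

edgeCount-attach : ∀ {n} (G : Graph n) c → edgeCount (attachGraph G c) ≡ suc (edgeCount G)
edgeCount-attach {n} G c = begin
  Σℕ (suc n) (λ i → Σℕ (suc n) (e i))
    ≡⟨ Σℕ-suc n (λ i → Σℕ (suc n) (e i)) ⟩
  Σℕ (suc n) (e zero) ℕ.+ Σℕ n (λ i → Σℕ (suc n) (e (suc i)))
    ≡⟨ cong₂ ℕ._+_ (trans (Σℕ-suc n (e zero)) (Σℕ-identity n c)) (Σℕ-cong n old) ⟩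
  suc (edgeCount G) ∎
  where
  e = edgeAt (attachGraph G c)
  old : ∀ i → Σℕ (suc n) (e (suc i)) ≡ Σℕ n (edgeAt G i)
  -- The pendant edge is not counted a second time here, since nothing is `<ᵇ` zero.
  old i = trans (Σℕ-suc n (e (suc i)))
    (cong (λ b → (if b then 1 else 0) ℕ.+ Σℕ n (edgeAt G i)) (∧-zeroʳ (does (c ≟ᶠ i))))

walk-snoc : ∀ {n} {G : Graph n} {i j k} → Walk G i j → adj G j k ≡ true → Walk G i k
walk-snoc here       e = step e here
walk-snoc (step d w) e = step d (walk-snoc w e)

walk-attach : ∀ {n} {G : Graph n} c {i j} → Walk G i j → Walk (attachGraph G c) (suc i) (suc j)
walk-attach c here       = here
walk-attach c (step e w) = step e (walk-attach c w)

≟-refl : ∀ {n} (c : Fin n) → does (c ≟ᶠ c) ≡ true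
≟-refl zero    = refl
≟-refl (suc c) = ≟-refl c

bicyclic-attach : ∀ {n} (G : Graph n) c → Bicyclic G → Bicyclic (attachGraph G c)
bicyclic-attach {n} G c (connected , edges) =
  connected′ , trans (edgeCount-attach G c) (cong suc edges)
  where
  connected′ : Connected (attachGraph G c)
  connected′ zero    zero    = here
  connected′ zero    (suc j) = step (≟-refl c) (walk-attach c (connected c j))
  connected′ (suc i) zero    = walk-snoc (walk-attach c (connected i c)) (≟-refl c)
  connected′ (suc i) (suc j) = walk-attach c (connected i j)

-- Rooted bicyclic graphs and the growth of their nullity.

-- The index counts the vertices other than the root, so the graph without its root is a `minor` of
-- size `n`. The fields `whole` and `rest` hold the coefficients of F and H.
record Rooted (n : ℕ) : Set where
  field
    graph     : Graph (suc n)
    signature : Signature graph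
    root      : Fin (suc n)
    bicyclic  : Bicyclic graph

  matrix : Matrix (suc n)
  matrix = adjMatrix graph signature

  whole rest : ℕ → ℤ
  whole = χ matrix
  rest  = χ (minor root root matrix)

open Rooted

pendantAt : ∀ {n} (R : Rooted n) → Fin (suc n) → Rooted (suc n)
pendantAt R c = record
  { graph     = attachGraph (graph R) c
  ; signature = attachSignature c (signature R)
  ; root      = suc (root R)
  ; bicyclic  = bicyclic-attach (graph R) c (bicyclic R)
  }

addPendant : ∀ {n} → Rooted n → Rooted (suc n)
addPendant R = pendantAt R (root R)

-- Here `zero` is the vertex just created by `addPendant`, so the result is a pendant path with two
-- edges at the root.
addBranch : ∀ {n} → Rooted n → Rooted (suc (suc n))
addBranch R = pendantAt (addPendant R) zero

whole-addPendant : ∀ {n} (R : Rooted n) k → whole (addPendant R) k ≡ shift (whole R) k - rest R k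
whole-addPendant R k = trans (χ-cong (adjMatrix-attach (graph R) (signature R) (root R)) k)
                             (χ-attach (matrix R) (root R) k)

-- Deleting the root isolates its pendant vertex.
minor-addPendant : ∀ {n} (R : Rooted n) i j → let c = root R in
  minor (suc c) (suc c) (matrix (addPendant R)) i j ≡ isolate (minor c c (matrix R)) i j
minor-addPendant R zero    zero    = refl
minor-addPendant R zero    (suc j) = identity-punchInʳ (root R) j
minor-addPendant R (suc i) zero    = identity-punchInʳ (root R) i
minor-addPendant R (suc i) (suc j) = refl

-- Deleting the root detaches the path, of which one separate edge remains: a pendant vertex on an
-- isolated one.
minor-addBranch : ∀ {n} (R : Rooted n) i j → let c = root R in
  minor (suc (suc c)) (suc (suc c)) (matrix (addBranch R)) i j ≡
  attach (isolate (minor c c (matrix R))) zero i j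
minor-addBranch R zero          zero          = refl
minor-addBranch R zero          (suc zero)    = refl
minor-addBranch R zero          (suc (suc j)) = refl
minor-addBranch R (suc zero)    zero          = refl
minor-addBranch R (suc (suc i)) zero          = refl
minor-addBranch R (suc i)       (suc j)       = minor-addPendant R i j

rest-addPendant : ∀ {n} (R : Rooted n) k → rest (addPendant R) k ≡ shift (rest R) k
rest-addPendant R k = trans (χ-cong (minor-addPendant R) k) (χ-isolate (minor (root R) (root R) (matrix R)) k)

whole-addBranch : ∀ {n} (R : Rooted n) k →
  whole (addBranch R) k ≡ shift (whole (addPendant R)) k - whole R k
whole-addBranch R k =
  trans (χ-cong (adjMatrix-attach (graph (addPendant R)) (signature (addPendant R)) zero) k)
        (χ-attach (matrix (addPendant R)) zero k)

rest-addBranch : ∀ {n} (R : Rooted n) k →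
  rest (addBranch R) k ≡ shift (shift (rest R)) k - rest R k
rest-addBranch R k = begin
  rest (addBranch R) k                          ≡⟨ χ-cong (minor-addBranch R) k ⟩
  χ (attach (isolate M) zero) k                 ≡⟨ χ-attach (isolate M) zero k ⟩
  shift (χ (isolate M)) k - χ M k               ≡⟨ cong (_- χ M k) (shift-cong (χ-isolate M) k) ⟩
  shift (shift (χ M)) k - χ M k                 ∎
  where
  M = minor (root R) (root R) (matrix R)

Opposite : ℤ → ℤ → Set
Opposite x y = (0ℤ ℤ.< x × y ℤ.< 0ℤ) ⊎ (x ℤ.< 0ℤ × 0ℤ ℤ.< y)

opposite-neg : ∀ {x y} → Opposite x y → Opposite (0ℤ - x) (0ℤ - y)
opposite-neg {x} {y} o rewrite +-identityˡ (- x) | +-identityˡ (- y) = case o of λ where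
  (inj₁ (0<x , y<0)) → inj₂ (ℤₚ.neg-mono-< 0<x , ℤₚ.neg-mono-< y<0)
  (inj₂ (x<0 , 0<y)) → inj₁ (ℤₚ.neg-mono-< x<0 , ℤₚ.neg-mono-< 0<y)

opposite-sub : ∀ {x y} → Opposite x y → Opposite (x - y) y
opposite-sub (inj₁ (0<x , y<0)) = inj₁ (ℤₚ.+-mono-< 0<x (ℤₚ.neg-mono-< y<0) , y<0)
opposite-sub (inj₂ (x<0 , 0<y)) = inj₂ (ℤₚ.+-mono-< x<0 (ℤₚ.neg-mono-< 0<y) , 0<y)

opposite-nonzero : ∀ {x y} → Opposite x y → x ≢ 0ℤ
opposite-nonzero (inj₁ (0<x , _)) refl = ℤₚ.<-irrefl refl 0<x
opposite-nonzero (inj₂ (x<0 , _)) refl = ℤₚ.<-irrefl refl x<0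

-- x^a divides whole and x^(a+1) divides rest, with leading coefficients of opposite signs.
-- Opposite signs cannot cancel in the difference x · whole - rest of addPendant.
record Nullity {n} (a : ℕ) (R : Rooted n) : Set where
  field
    whole-zero : ∀ {j} → j < a → whole R j ≡ 0ℤ
    rest-zero  : ∀ {j} → j ≤ a → rest R j ≡ 0ℤ
    leading    : Opposite (whole R a) (rest R (suc a))

open Nullity

nullity-addPendant : ∀ {n a} (R : Rooted n) → Nullity a R → Nullity (suc a) (addPendant R)
nullity-addPendant {a = a} R N = record
  { whole-zero = λ {j} j≤a → trans (whole-addPendant R j)
      (cong₂ _-_ (shift-zero (whole-zero N) j≤a) (rest-zero N (ℕₚ.≤-pred j≤a)))
  ; rest-zero  = λ {j} j≤1+a → trans (rest-addPendant R j) (shift-zero (rest-zero N ∘ ℕₚ.≤-pred) (s≤s j≤1+a))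
  ; leading    = subst (λ x → Opposite x (rest (addPendant R) (suc (suc a)))) (sym (whole-addPendant R (suc a)))
      (subst (Opposite (whole R a - rest R (suc a))) (sym (rest-addPendant R (suc (suc a)))) (opposite-sub (leading N)))
  }
  where
  shift-zero : ∀ {f : ℕ → ℤ} {a} → (∀ {j} → j < a → f j ≡ 0ℤ) → ∀ {j} → j < suc a → shift f j ≡ 0ℤ
  shift-zero f≡0 {zero}  _         = refl
  shift-zero f≡0 {suc j} (s≤s j<a) = f≡0 j<a

-- At these lowest indices every shifted term is 0, so both leading coefficients merely change sign.
-- This is where nullity 0 enters, and why branches are added before pendant vertices.
nullity-addBranch : ∀ {n} (R : Rooted n) → Nullity 0 R → Nullity 0 (addBranch R)
nullity-addBranch R N = record
  { whole-zero = λ ()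
  ; rest-zero  = λ { z≤n → trans (rest-addBranch R 0) (cong (λ x → 0ℤ - x) (rest-zero N z≤n)) }
  ; leading    = subst (λ x → Opposite x (rest (addBranch R) 1)) (sym (whole-addBranch R 0))
      (subst (Opposite (0ℤ - whole R 0)) (sym (rest-addBranch R 1)) (opposite-neg (leading N)))
  }

η-nullity : ∀ {n a} (R : Rooted n) → Nullity a R → η (graph R) (signature R) ≡ a
η-nullity {a = a} R N = mult0-≡ (charPoly _ (matrix R)) a
  (λ j j<a → trans (coeff-charPoly (matrix R) j) (whole-zero N j<a))
  (λ p≡0 → opposite-nonzero (leading N) (trans (sym (coeff-charPoly (matrix R) a)) p≡0))

-- K₄ minus the edge {2,3}, whose 4-cycle 0-2-1-3 is made negative by the edge {0,2}.
diamond : Graph 4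
diamond = record
  { adj    = edge
  ; sym    = from-yes (all? λ i → all? λ j → edge i j ≟ᵇ edge j i)
  ; irrefl = from-yes (all? λ i → edge i i ≟ᵇ false)
  }
  where
  edge : Fin 4 → Fin 4 → Bool
  edge 2F 3F = false
  edge 3F 2F = false
  edge i  j  = not (does (i ≟ᶠ j))

diamondSignature : Signature diamond
diamondSignature = record
  { σ    = sign
  ; σsym = from-yes (all? λ i → all? λ j → sign i j ≟ˢ sign j i)
  }
  where
  sign : Fin 4 → Fin 4 → Sign
  sign 0F 2F = Sign.-
  sign 2F 0F = Sign.-
  sign _  _  = Sign.+

diamondAt : Fin 4 → Rooted 3
diamondAt c = record
  { graph     = diamond
  ; signature = diamondSignature
  ; root      = c
  ; bicyclic  = (λ i j → walk-snoc′ i (from0 j)) , refl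
  }
  where
  from0 : ∀ j → Walk diamond 0F j
  from0 0F = here
  from0 1F = step refl here
  from0 2F = step refl here
  from0 3F = step refl here
  walk-snoc′ : ∀ i {j} → Walk diamond 0F j → Walk diamond i j
  walk-snoc′ 0F w = w
  walk-snoc′ 1F w = step refl w
  walk-snoc′ 2F w = step refl w
  walk-snoc′ 3F w = step refl w

-- The two cores and the families grown from them.

-- F has constant term 4, the fourth-order minor (-1 - 1)². Deleting the root 0 leaves the path
-- 2-1-3 with H = x³ - 2x, so the leading coefficients are 4 and -2.
evenCore : Rooted 3
evenCore = diamondAt 0F

-- Deleting vertex 2 of the diamond leaves an all-positive triangle, with polynomial x³ - 3x - 2.
-- After the pendant vertex is added, the leading coefficients are therefore 2 and -2.
oddCore : Rooted 4
oddCore = addPendant (diamondAt 2F)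

nullity-evenCore : Nullity 0 evenCore
nullity-evenCore = record
  { whole-zero = λ () ; rest-zero = λ { z≤n → refl } ; leading = inj₁ (+<+ (s≤s z≤n) , -<+) }

nullity-oddCore : Nullity 0 oddCore
nullity-oddCore = record
  { whole-zero = λ () ; rest-zero = λ { z≤n → refl } ; leading = inj₁ (+<+ (s≤s z≤n) , -<+) }

addPendants : ∀ {n} p → Rooted n → Rooted (p ℕ.+ n)
addPendants zero    R = R
addPendants (suc p) R = addPendant (addPendants p R)

addBranches : ∀ {n} q → Rooted n → Rooted (q ℕ.* 2 ℕ.+ n)
addBranches zero    R = R
addBranches (suc q) R = addBranch (addBranches q R)

nullity-family : ∀ {n} p q (R : Rooted n) → Nullity 0 R → Nullity p (addPendants p (addBranches q R))
nullity-family zero    zero    R N = N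
nullity-family zero    (suc q) R N = nullity-addBranch (addBranches q R) (nullity-family zero q R N)
nullity-family (suc p) q       R N = nullity-addPendant (addPendants p (addBranches q R)) (nullity-family p q R N)

Realizable : ℕ → ℕ → Set
Realizable n k = Σ (Graph n) λ G → Bicyclic G × Σ (Signature G) λ s → η G s ≡ k

realize : ∀ {m} k q (R : Rooted m) → Nullity 0 R → Realizable (suc (k ℕ.+ (q ℕ.* 2 ℕ.+ m))) k
realize k q R N = graph S , bicyclic S , signature S , η-nullity S (nullity-family k q R N)
  where S = addPendants k (addBranches q R)

halve : ∀ t → ∃ λ q → t ≡ q ℕ.* 2 ⊎ t ≡ suc (q ℕ.* 2)
halve zero          = 0 , inj₁ refl
halve (suc zero)    = 0 , inj₂ refl
halve (suc (suc t)) with halve t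
... | q , inj₁ refl = suc q , inj₁ refl
... | q , inj₂ refl = suc q , inj₂ refl

realizable : ∀ n k → 4 ≤ n → k ≤ n ∸ 4 → Realizable n k
-- This many vertices remain after a core of four vertices and `k` pendant vertices. Pairs of them
-- become branches; an odd one is absorbed by the core with five vertices.
realizable n k 4≤n k≤n∸4 with halve (n ∸ 4 ∸ k)
... | q , inj₁ even = subst (λ m → Realizable m k)
  (trans (count k (q ℕ.* 2)) (size even)) (realize k q evenCore nullity-evenCore)
  where
  count : ∀ k t → suc (k ℕ.+ (t ℕ.+ 3)) ≡ t ℕ.+ k ℕ.+ 4
  count = ℕ-solve-∀
  size : ∀ {t} → n ∸ 4 ∸ k ≡ t → t ℕ.+ k ℕ.+ 4 ≡ n
  size refl = trans (cong (ℕ._+ 4) (ℕₚ.m∸n+n≡m k≤n∸4)) (ℕₚ.m∸n+n≡m 4≤n)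
... | q , inj₂ odd = subst (λ m → Realizable m k)
  (trans (count k (q ℕ.* 2)) (size odd)) (realize k q oddCore nullity-oddCore)
  where
  count : ∀ k t → suc (k ℕ.+ (t ℕ.+ 4)) ≡ suc t ℕ.+ k ℕ.+ 4
  count = ℕ-solve-∀
  size : ∀ {t} → n ∸ 4 ∸ k ≡ t → t ℕ.+ k ℕ.+ 4 ≡ n
  size refl = trans (cong (ℕ._+ 4) (ℕₚ.m∸n+n≡m k≤n∸4)) (ℕₚ.m∸n+n≡m 4≤n)

-- Counting with duplicate-free lists.

-- One occurrence of the head of `xs` is cut out of `ys`; the tail of `xs` avoids the head and so
-- still lies in what remains.
unique-⊆-length : ∀ {A : Set} {xs ys : List A} → Unique xs → xs ⊆ ys → length xs ≤ length ys
unique-⊆-length {xs = []}     _            _     = z≤n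
unique-⊆-length {xs = x ∷ xs} (x∉xs ∷ xs!) xs⊆ys with ∈-∃++ (xs⊆ys (here refl))
... | as , bs , refl = subst (suc (length xs) ≤_) (sym (length-++-sucʳ as x bs))
        (s≤s (unique-⊆-length xs! λ {y} y∈xs → drop y∈xs (∈-++⁻ as (xs⊆ys (there y∈xs)))))
  where
  drop : ∀ {y} → y ∈ xs → y ∈ as ⊎ y ∈ x ∷ bs → y ∈ as ++ bs
  drop y∈xs (inj₁ y∈as)          = ∈-++⁺ˡ y∈as
  drop y∈xs (inj₂ (here refl))   = contradiction refl (All.lookup x∉xs y∈xs)
  drop y∈xs (inj₂ (there y∈bs))  = ∈-++⁺ʳ as y∈bs

-- Otherwise `allFin n` would be a duplicate-free list contained in a shorter one.
fresh : ∀ {n} (xs : List (Fin n)) → length xs < n → ∃ λ v → v ∉ xs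
fresh {n} xs short with any? (λ v → ¬? (v ∈? xs))
  where open DecMembership (_≟ᶠ_ {n}) using (_∈?_)
... | yes found = found
... | no  none  = contradiction
  (subst (_≤ length xs) (length-tabulate {n = n} (λ i → i))
    (unique-⊆-length (Unique.allFin⁺ n) λ {v} _ → decidable-stable (v ∈? xs) (λ v∉xs → none (v , v∉xs))))
  (ℕₚ.<⇒≱ short)
  where open DecMembership (_≟ᶠ_ {n}) using (_∈?_)

-- Principal minors of order 4

quadratic : ℤ → ℤ → ℤ → ℤ
quadratic p q r = p * p + q * q + r * r - (p * q + p * r + q * r) - (p * q + p * r + q * r)

-- the principal minor of a hollow symmetric matrix on the rows a, b, c, d
minor₄ : ∀ {n} → Matrix n → (a b c d : Fin n) → ℤ
minor₄ A a b c d = quadratic (A a b * A c d) (A a c * A b d) (A a d * A b c)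

0≤i*i : ∀ i → 0ℤ ℤ.≤ i * i
0≤i*i +0       = +≤+ z≤n
0≤i*i +[1+ n ] = +≤+ z≤n
0≤i*i -[1+ n ] = +≤+ z≤n

quadratic-p≡0 : ∀ {p} q r → p ≡ 0ℤ → 0ℤ ℤ.≤ quadratic p q r
quadratic-p≡0 q r refl = subst (0ℤ ℤ.≤_) (square q r) (0≤i*i (q - r))
  where
  square : ∀ q r → (q - r) * (q - r) ≡
    0ℤ * 0ℤ + q * q + r * r - (0ℤ * q + 0ℤ * r + q * r) - (0ℤ * q + 0ℤ * r + q * r)
  square = solve-∀

quadratic-q≡0 : ∀ p {q} r → q ≡ 0ℤ → 0ℤ ℤ.≤ quadratic p q r
quadratic-q≡0 p r refl = subst (0ℤ ℤ.≤_) (square p r) (0≤i*i (p - r))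
  where
  square : ∀ p r → (p - r) * (p - r) ≡
    p * p + 0ℤ * 0ℤ + r * r - (p * 0ℤ + p * r + 0ℤ * r) - (p * 0ℤ + p * r + 0ℤ * r)
  square = solve-∀

quadratic-r≡0 : ∀ p q {r} → r ≡ 0ℤ → 0ℤ ℤ.≤ quadratic p q r
quadratic-r≡0 p q refl = subst (0ℤ ℤ.≤_) (square p q) (0≤i*i (p - q))
  where
  square : ∀ p q → (p - q) * (p - q) ≡
    p * p + q * q + 0ℤ * 0ℤ - (p * q + p * 0ℤ + q * 0ℤ) - (p * q + p * 0ℤ + q * 0ℤ)
  square = solve-∀

-- Determinants of hollow matrices of order 4.

zeroMatrix : ∀ {n} → Matrix n
zeroMatrix _ _ = 0ℤ

determinant : ∀ {n} → Matrix n → ℤ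
determinant {n} A = pencil n A zeroMatrix 0

-- The x-part enters only through `shift`, which is 0 at index 0.
pencil-at-0 : ∀ n (A B : Matrix n) → pencil n A B 0 ≡ determinant A
pencil-at-0 zero    A B = refl
pencil-at-0 (suc n) A B = sum-cong-≗ λ j → cong (alt (toℕ j) *_)
  (cong₂ (λ u v → A zero j * u + v) (pencil-at-0 n (minor zero j A) (minor zero j B)) (*-zeroʳ (B zero j)))

determinant₂ : (A : Matrix 2) → determinant A ≡ A 0F 0F * A 1F 1F - A 0F 1F * A 1F 0F
determinant₂ A = lem (A 0F 0F) (A 0F 1F) (A 1F 0F) (A 1F 1F)
  where
  lem : ∀ a b c d →
    1ℤ * (a * (1ℤ * (d * 1ℤ + 0ℤ) + 0ℤ) + 0ℤ) + (-1ℤ * (b * (1ℤ * (c * 1ℤ + 0ℤ) + 0ℤ) + 0ℤ) + 0ℤ) ≡ a * d - b * c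
  lem = solve-∀

determinant₃ : (A : Matrix 3) → determinant A ≡
  A 0F 0F * (A 1F 1F * A 2F 2F - A 1F 2F * A 2F 1F)
  - A 0F 1F * (A 1F 0F * A 2F 2F - A 1F 2F * A 2F 0F)
  + A 0F 2F * (A 1F 0F * A 2F 1F - A 1F 1F * A 2F 0F)
determinant₃ A = trans
  (lem (A 0F 0F) (A 0F 1F) (A 0F 2F)
    (determinant (minor 0F 0F A)) (determinant (minor 0F 1F A)) (determinant (minor 0F 2F A)))
  (cong₂ _+_ (cong₂ (λ u v → A 0F 0F * u - A 0F 1F * v) (determinant₂ (minor 0F 0F A)) (determinant₂ (minor 0F 1F A)))
             (cong (A 0F 2F *_) (determinant₂ (minor 0F 2F A))))
  where
  lem : ∀ a b c x y z →
    1ℤ * (a * x + 0ℤ) + (-1ℤ * (b * y + 0ℤ) + (1ℤ * (c * z + 0ℤ) + 0ℤ)) ≡ a * x - b * y + c * z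
  lem = solve-∀

-- The arguments are the entries 01, 02, 03, 12, 13, 23. Symmetry and the zero diagonal hold by
-- computation, so the determinant becomes a polynomial identity in six variables.
hollow₄ : (a b c d e f : ℤ) → Matrix 4
hollow₄ a b c d e f 0F 1F = a
hollow₄ a b c d e f 0F 2F = b
hollow₄ a b c d e f 0F 3F = c
hollow₄ a b c d e f 1F 0F = a
hollow₄ a b c d e f 1F 2F = d
hollow₄ a b c d e f 1F 3F = e
hollow₄ a b c d e f 2F 0F = b
hollow₄ a b c d e f 2F 1F = d
hollow₄ a b c d e f 2F 3F = f
hollow₄ a b c d e f 3F 0F = c
hollow₄ a b c d e f 3F 1F = e
hollow₄ a b c d e f 3F 2F = f
hollow₄ a b c d e f _  _  = 0ℤ

determinant-hollow₄ : ∀ a b c d e f →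
  determinant (hollow₄ a b c d e f) ≡ quadratic (a * f) (b * e) (c * d)
determinant-hollow₄ a b c d e f = trans
  (cong₂ (λ u v → 0ℤ + (- 1ℤ * (a * u + 0ℤ) + v)) (determinant₃ (minor 0F 1F A))
    (cong₂ (λ u v → 1ℤ * (b * u + 0ℤ) + (- 1ℤ * (c * v + 0ℤ) + 0ℤ))
      (determinant₃ (minor 0F 2F A)) (determinant₃ (minor 0F 3F A))))
  (lem a b c d e f)
  where
  A = hollow₄ a b c d e f
  lem : ∀ a b c d e f →
    0ℤ + ((- 1ℤ * (a * (a * (0ℤ * 0ℤ - f * f) - d * (b * 0ℤ - f * c) + e * (b * f - 0ℤ * c)) + 0ℤ)) +
    (1ℤ * (b * (a * (d * 0ℤ - f * e) - 0ℤ * (b * 0ℤ - f * c) + e * (b * e - d * c)) + 0ℤ) +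
    (- 1ℤ * (c * (a * (d * f - 0ℤ * e) - 0ℤ * (b * f - 0ℤ * c) + d * (b * e - d * c)) + 0ℤ) + 0ℤ)))
    ≡ a * f * (a * f) + b * e * (b * e) + c * d * (c * d)
      - (a * f * (b * e) + a * f * (c * d) + b * e * (c * d))
      - (a * f * (b * e) + a * f * (c * d) + b * e * (c * d))
  lem = solve-∀

record Hollow {n} (A : Matrix n) : Set where
  field
    symmetric : ∀ i j → A i j ≡ A j i
    diagonal  : ∀ i → A i i ≡ 0ℤ

open Hollow

determinant₄ : (A : Matrix 4) → Hollow A → determinant A ≡ minor₄ A 0F 1F 2F 3F
determinant₄ A h = trans
  (pencil-cong 4 A (hollow₄ a b c d e f) zeroMatrix zeroMatrix entries (λ _ _ → refl) 0)
  (determinant-hollow₄ a b c d e f)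
  where
  a = A 0F 1F
  b = A 0F 2F
  c = A 0F 3F
  d = A 1F 2F
  e = A 1F 3F
  f = A 2F 3F
  entries : ∀ i j → A i j ≡ hollow₄ a b c d e f i j
  entries 0F 0F = diagonal h 0F
  entries 0F 1F = refl
  entries 0F 2F = refl
  entries 0F 3F = refl
  entries 1F 0F = symmetric h 1F 0F
  entries 1F 1F = diagonal h 1F
  entries 1F 2F = refl
  entries 1F 3F = refl
  entries 2F 0F = symmetric h 2F 0F
  entries 2F 1F = symmetric h 2F 1F
  entries 2F 2F = diagonal h 2F
  entries 2F 3F = refl
  entries 3F 0F = symmetric h 3F 0F
  entries 3F 1F = symmetric h 3F 1F
  entries 3F 2F = symmetric h 3F 2F
  entries 3F 3F = diagonal h 3F

-- Exchanging two neighbouring rows fixes one of the three matchings and exchanges the other two,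
-- and `quadratic` is symmetric in its arguments. The two lemmas that follow rest on the same
-- reason.
minor₄-swap₁₂ : ∀ {n} {A : Matrix n} → Hollow A → ∀ a b c d → minor₄ A b a c d ≡ minor₄ A a b c d
minor₄-swap₁₂ {A = A} h a b c d = trans
  (cong (λ x → quadratic (x * A c d) (A b c * A a d) (A b d * A a c)) (symmetric h b a))
  (lem (A a b) (A c d) (A b c) (A a d) (A b d) (A a c))
  where
  lem : ∀ x y z w u v →
    x * y * (x * y) + z * w * (z * w) + u * v * (u * v)
      - (x * y * (z * w) + x * y * (u * v) + z * w * (u * v))
      - (x * y * (z * w) + x * y * (u * v) + z * w * (u * v)) ≡
    x * y * (x * y) + v * u * (v * u) + w * z * (w * z)
      - (x * y * (v * u) + x * y * (w * z) + v * u * (w * z))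
      - (x * y * (v * u) + x * y * (w * z) + v * u * (w * z))
  lem = solve-∀

minor₄-swap₂₃ : ∀ {n} {A : Matrix n} → Hollow A → ∀ a b c d → minor₄ A a c b d ≡ minor₄ A a b c d
minor₄-swap₂₃ {A = A} h a b c d = trans
  (cong (λ x → quadratic (A a c * A b d) (A a b * A c d) (A a d * x)) (symmetric h c b))
  (lem (A a c * A b d) (A a b * A c d) (A a d * A b c))
  where
  lem : ∀ p q r → p * p + q * q + r * r - (p * q + p * r + q * r) - (p * q + p * r + q * r) ≡
                  q * q + p * p + r * r - (q * p + q * r + p * r) - (q * p + q * r + p * r)
  lem = solve-∀

minor₄-swap₃₄ : ∀ {n} {A : Matrix n} → Hollow A → ∀ a b c d → minor₄ A a b d c ≡ minor₄ A a b c d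
minor₄-swap₃₄ {A = A} h a b c d = trans
  (cong (λ x → quadratic (A a b * x) (A a d * A b c) (A a c * A b d)) (symmetric h d c))
  (lem (A a b * A c d) (A a d * A b c) (A a c * A b d))
  where
  lem : ∀ p q r → p * p + q * q + r * r - (p * q + p * r + q * r) - (p * q + p * r + q * r) ≡
                  p * p + r * r + q * q - (p * r + p * q + r * q) - (p * r + p * q + r * q)
  lem = solve-∀

-- Reduction of four distinct indices to increasing order.

module _ {n : ℕ} (P : (a b c d : Fin n) → Set)
  (swap₁₂ : ∀ {a b c d} → P b a c d → P a b c d)
  (swap₂₃ : ∀ {a b c d} → P a c b d → P a b c d)
  (swap₃₄ : ∀ {a b c d} → P a b d c → P a b c d)
  (sorted : ∀ {a b c d} → a Fin.< b → b Fin.< c → c Fin.< d → P a b c d)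
  where

  insert₁ : ∀ {a b c d} → a ≢ b → a ≢ c → a ≢ d → b Fin.< c → c Fin.< d → P a b c d
  insert₁ {a} {b} {c} {d} a≢b a≢c a≢d b<c c<d with <-cmp a b
  ... | tri< a<b _ _ = sorted a<b b<c c<d
  ... | tri≈ _ a≡b _ = contradiction a≡b a≢b
  ... | tri> _ _ b<a with <-cmp a c
  ...   | tri< a<c _ _ = swap₁₂ (sorted b<a a<c c<d)
  ...   | tri≈ _ a≡c _ = contradiction a≡c a≢c
  ...   | tri> _ _ c<a with <-cmp a d
  ...     | tri< a<d _ _ = swap₁₂ (swap₂₃ (sorted b<c c<a a<d))
  ...     | tri≈ _ a≡d _ = contradiction a≡d a≢d
  ...     | tri> _ _ d<a = swap₁₂ (swap₂₃ (swap₃₄ (sorted b<c c<d d<a)))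

  insert₂ : ∀ {a b c d} → a ≢ b → a ≢ c → a ≢ d → b ≢ c → b ≢ d → c Fin.< d → P a b c d
  insert₂ {a} {b} {c} {d} a≢b a≢c a≢d b≢c b≢d c<d with <-cmp b c
  ... | tri< b<c _ _ = insert₁ a≢b a≢c a≢d b<c c<d
  ... | tri≈ _ b≡c _ = contradiction b≡c b≢c
  ... | tri> _ _ c<b with <-cmp b d
  ...   | tri< b<d _ _ = swap₂₃ (insert₁ a≢c a≢b a≢d c<b b<d)
  ...   | tri≈ _ b≡d _ = contradiction b≡d b≢d
  ...   | tri> _ _ d<b = swap₂₃ (swap₃₄ (insert₁ a≢c a≢d a≢b c<d d<b))

  -- Insertion sort by adjacent transpositions: first `c` and `d` are ordered, then `b` is inserted,
  -- then `a`.
  from-sorted : ∀ {a b c d} → Unique (a ∷ b ∷ c ∷ d ∷ []) → P a b c d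
  from-sorted {c = c} {d} ((a≢b ∷ a≢c ∷ a≢d ∷ []) ∷ (b≢c ∷ b≢d ∷ []) ∷ (c≢d ∷ []) ∷ _) with <-cmp c d
  ... | tri< c<d _ _ = insert₂ a≢b a≢c a≢d b≢c b≢d c<d
  ... | tri≈ _ c≡d _ = contradiction c≡d c≢d
  ... | tri> _ _ d<c = swap₃₄ (insert₂ a≢b a≢d a≢c b≢d b≢c d<c)

sorted₄ : ∀ {P : (a b c d : Fin 4) → Set} → P 0F 1F 2F 3F →
  ∀ {a b c d} → a Fin.< b → b Fin.< c → c Fin.< d → P a b c d
sorted₄ p {0F} {1F} {2F} {3F} _ _ _ = p
sorted₄ p {_}  {0F}           () _  _
sorted₄ p {suc _} {1F}        (s≤s ()) _ _
sorted₄ p {_} {_} {0F}        _ () _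
sorted₄ p {_} {suc _} {1F}    _ (s≤s ()) _
sorted₄ p {_} {suc (suc _)} {2F} _ (s≤s (s≤s ())) _
sorted₄ p {_} {_} {_} {0F} _ _ ()
sorted₄ p {_} {_} {suc _} {1F} _ _ (s≤s ())
sorted₄ p {_} {_} {suc (suc _)} {2F} _ _ (s≤s (s≤s ()))
sorted₄ p {_} {_} {3F} {3F} _ _ (s≤s (s≤s (s≤s ())))

determinant-minor₄ : (A : Matrix 4) → Hollow A → ∀ {a b c d} → Unique (a ∷ b ∷ c ∷ d ∷ []) →
  minor₄ A a b c d ≡ determinant A
determinant-minor₄ A h = from-sorted (λ a b c d → minor₄ A a b c d ≡ determinant A)
  (λ {a} {b} {c} {d} → trans (sym (minor₄-swap₁₂ h a b c d)))
  (λ {a} {b} {c} {d} → trans (sym (minor₄-swap₂₃ h a b c d)))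
  (λ {a} {b} {c} {d} → trans (sym (minor₄-swap₃₄ h a b c d)))
  (sorted₄ {λ a b c d → minor₄ A a b c d ≡ determinant A} (sym (determinant₄ A h)))

-- Sign of the coefficient formed from minors of order 4.

record NonNegative {n} (A : Matrix n) : Set where
  field
    hollow : Hollow A
    minors : ∀ {a b c d} → Unique (a ∷ b ∷ c ∷ d ∷ []) → 0ℤ ℤ.≤ minor₄ A a b c d

open NonNegative

nonNegative-minor : ∀ {n} (A : Matrix (suc n)) r → NonNegative A → NonNegative (minor r r A)
nonNegative-minor A r N = record
  { hollow = record
    { symmetric = λ i j → symmetric (hollow N) (punchIn r i) (punchIn r j)
    ; diagonal  = λ i → diagonal (hollow N) (punchIn r i)
    }
  ; minors = λ abcd! → minors N (Unique.map⁺ (punchIn-injective r _ _) abcd!)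
  }

-- Keeping x only in the rows selected by `b` allows it to be removed from one row at a time.
maskedIdentity : ∀ {n} → (Fin n → Bool) → Matrix n
maskedIdentity b i j = if b i then identity i j else 0ℤ

clear : ∀ {n} → Fin n → (Fin n → Bool) → Fin n → Bool
clear r b i = not (does (r ≟ᶠ i)) ∧ b i

≟-punchIn : ∀ {n} (r : Fin (suc n)) i → does (r ≟ᶠ punchIn r i) ≡ false
≟-punchIn         zero    i       = refl
≟-punchIn {suc n} (suc r) zero    = refl
≟-punchIn {suc n} (suc r) (suc i) = ≟-punchIn r i

-- This is `pencil-split-row` at a diagonal position: the two signs are equal and cancel, and the
-- minor is again a pencil with a masked identity.
pencil-clear : ∀ n (A : Matrix (suc n)) r b → b r ≡ true → ∀ k →
  pencil (suc n) A (maskedIdentity b) k ≡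
  pencil (suc n) A (maskedIdentity (clear r b)) k
    + shift (pencil n (minor r r A) (maskedIdentity (b ∘ punchIn r))) k
pencil-clear n A r b br k = begin
  pencil (suc n) A (maskedIdentity b) k
    ≡⟨ pencil-split-row n r r A (maskedIdentity b) (maskedIdentity (clear r b))
         (λ i j → cong (λ c → if not c ∧ b (punchIn r i) then identity (punchIn r i) j else 0ℤ) (≟-punchIn r i))
         (λ j → cong (λ c → if not c ∧ b r then identity r j else 0ℤ) (≟-refl r))
         (trans (cong (λ c → if c then identity r r else 0ℤ) br) (identity-diagonal r))
         (λ j → trans (cong (λ c → if c then identity r (punchIn r j) else 0ℤ) br) (identity-punchInʳ r j)) k ⟩
  p + s * (s * shift m k)                            ≡⟨ cong (p +_) (*-assoc s s (shift m k)) ⟨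
  p + s * s * shift m k                              ≡⟨ cong (λ u → p + u * shift m k) (alt-square (toℕ r)) ⟩
  p + 1ℤ * shift m k                                 ≡⟨ cong (p +_) (*-identityˡ (shift m k)) ⟩
  p + shift m k                                      ≡⟨ cong (p +_) (shift-cong m≡m′ k) ⟩
  p + shift m′ k                                     ∎
  where
  s  = alt (toℕ r)
  p  = pencil (suc n) A (maskedIdentity (clear r b)) k
  m  = pencil n (minor r r A) (minor r r (maskedIdentity b))
  m′ = pencil n (minor r r A) (maskedIdentity (b ∘ punchIn r))
  m≡m′ : ∀ i → m i ≡ m′ i
  m≡m′ = pencil-cong n (minor r r A) (minor r r A) (minor r r (maskedIdentity b)) (maskedIdentity (b ∘ punchIn r))
    (λ _ _ → refl) (λ i j → cong (λ u → if b (punchIn r i) then u else 0ℤ) (identity-punchIn r i j))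

pencil-clear-≤ : ∀ n (A : Matrix (suc n)) r b → b r ≡ true → ∀ k →
  0ℤ ℤ.≤ pencil (suc n) A (maskedIdentity (clear r b)) (suc k) →
  0ℤ ℤ.≤ pencil n (minor r r A) (maskedIdentity (b ∘ punchIn r)) k →
  0ℤ ℤ.≤ pencil (suc n) A (maskedIdentity b) (suc k)
pencil-clear-≤ n A r b br k 0≤p 0≤m =
  subst (0ℤ ℤ.≤_) (sym (pencil-clear n A r b br (suc k))) (ℤₚ.+-mono-≤ 0≤p 0≤m)

pencil-clear-< : ∀ n (A : Matrix (suc n)) r k →
  0ℤ ℤ.≤ pencil (suc n) A (maskedIdentity (clear r (λ _ → true))) (suc k) →
  0ℤ ℤ.< pencil n (minor r r A) identity k →
  0ℤ ℤ.< pencil (suc n) A identity (suc k)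
pencil-clear-< n A r k 0≤p 0<m =
  subst (0ℤ ℤ.<_) (sym (pencil-clear n A r (λ _ → true) refl (suc k))) (ℤₚ.+-mono-≤-< 0≤p 0<m)

-- The graph of n = 4 + k. Matching on it keeps the size n of the matrices a variable, which
-- stops the type checker from expanding determinants of size 4 + k.
data FourMore : ℕ → ℕ → Set where
  four : FourMore 4 0
  more : ∀ {n k} → FourMore n k → FourMore (suc n) (suc k)

fourMore : ∀ k → FourMore (4 ℕ.+ k) k
fourMore zero    = four
fourMore (suc k) = more (fourMore k)

fourMore-4≤ : ∀ {n k} → FourMore n k → 4 ≤ n
fourMore-4≤ four     = ℕₚ.≤-refl
fourMore-4≤ (more e) = ℕₚ.m≤n⇒m≤1+n (fourMore-4≤ e)

-- Induction on m, a bound for the rows that still contain x.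
pencil-nonneg-more : ∀ {n k} →
  (∀ (A : Matrix n) → NonNegative A → ∀ b → 0ℤ ℤ.≤ pencil n A (maskedIdentity b) k) →
  ∀ (A : Matrix (suc n)) → NonNegative A → ∀ m b → (∀ i → m ≤ toℕ i → b i ≡ false) →
  0ℤ ℤ.≤ pencil (suc n) A (maskedIdentity b) (suc k)
-- No row contains x any more, so the coefficient of a positive power is 0.
pencil-nonneg-more {n} {k} ih A N zero b b≡false = ℤₚ.≤-reflexive (sym
  (pencil-constant (suc n) A (maskedIdentity b)
    (λ i j → cong (λ c → if c then identity i j else 0ℤ) (b≡false i z≤n)) k))
pencil-nonneg-more {n} {k} ih A N (suc m) b b≡false with m <? suc n
... | no m≮n = pencil-nonneg-more ih A N m b λ i m≤i →
  contradiction (ℕₚ.≤-<-trans m≤i (toℕ<n i)) m≮n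
... | yes m<n with b (fromℕ< m<n) ≟ᵇ true
...   | no br≢true = pencil-nonneg-more ih A N m b λ i m≤i → case ℕₚ.m≤n⇒m<n∨m≡n m≤i of λ where
  (inj₁ m<i)  → b≡false i m<i
  (inj₂ m≡i)  → subst (λ r → b r ≡ false) (toℕ-injective (trans (toℕ-fromℕ< m<n) m≡i)) (¬-not br≢true)
-- Row `r`, with index `m`, is the last one that contains x. Clearing it lowers the bound to `m`,
-- while the minor without it has size `n` and falls under `ih`.
...   | yes br = pencil-clear-≤ n A r b br k (pencil-nonneg-more ih A N m (clear r b) cleared)
                   (ih (minor r r A) (nonNegative-minor A r N) (b ∘ punchIn r))
  where
  r = fromℕ< m<n
  cleared : ∀ i → m ≤ toℕ i → clear r b i ≡ false
  cleared i m≤i with ℕₚ.m≤n⇒m<n∨m≡n m≤i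
  ... | inj₁ m<i = trans (cong (not (does (r ≟ᶠ i)) ∧_) (b≡false i m<i)) (∧-zeroʳ (not (does (r ≟ᶠ i))))
  ... | inj₂ m≡i = subst (λ i → clear r b i ≡ false) (toℕ-injective (trans (toℕ-fromℕ< m<n) m≡i))
                     (cong (λ c → not c ∧ b r) (≟-refl r))

-- As n = 4 + k, the coefficient is the sum of those principal minors of order 4 whose complementary
-- rows all contain x.
pencil-nonneg : ∀ {n k} → FourMore n k → (A : Matrix n) → NonNegative A → ∀ b →
  0ℤ ℤ.≤ pencil n A (maskedIdentity b) k
pencil-nonneg four A N b =
  subst (0ℤ ℤ.≤_) (trans (sym (determinant₄ A (hollow N))) (sym (pencil-at-0 4 A (maskedIdentity b))))
    (minors N (((λ ()) ∷ (λ ()) ∷ (λ ()) ∷ []) ∷ ((λ ()) ∷ (λ ()) ∷ []) ∷ ((λ ()) ∷ []) ∷ [] ∷ []))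
pencil-nonneg {suc n} (more e) A N b = pencil-nonneg-more (pencil-nonneg e) A N (suc n) b
  (λ i n≤i → contradiction (toℕ<n i) (ℕₚ.≤⇒≯ n≤i))

punchIn-surjective : ∀ {n} {r i : Fin (suc n)} → i ≢ r → ∃ λ j → punchIn r j ≡ i
punchIn-surjective i≢r = punchOut (i≢r ∘ sym) , punchIn-punchOut (i≢r ∘ sym)

-- A row `r` outside the four given ones is split off. The pencil with that row cleared contributes
-- a nonnegative amount, and the matrix without row `r` still contains the positive minor.
pencil-positive : ∀ {n k} → FourMore n k → (A : Matrix n) → NonNegative A →
  ∀ {a b c d} → Unique (a ∷ b ∷ c ∷ d ∷ []) → 0ℤ ℤ.< minor₄ A a b c d → 0ℤ ℤ.< pencil n A identity k
pencil-positive four A N abcd! 0<minor =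
  subst (0ℤ ℤ.<_) (trans (determinant-minor₄ A (hollow N) abcd!) (sym (pencil-at-0 4 A identity))) 0<minor
pencil-positive {suc n} {suc k} (more e) A N {a} {b} {c} {d} abcd! 0<minor
  with fresh (a ∷ b ∷ c ∷ d ∷ []) (s≤s (fourMore-4≤ e))
... | r , r∉ with punchIn-surjective {r = r} {i = a} (λ { refl → r∉ (here refl) })
               | punchIn-surjective {r = r} {i = b} (λ { refl → r∉ (there (here refl)) })
               | punchIn-surjective {r = r} {i = c} (λ { refl → r∉ (there (there (here refl))) })
               | punchIn-surjective {r = r} {i = d} (λ { refl → r∉ (there (there (there (here refl)))) })
... | a , refl | b , refl | c , refl | d , refl =
  pencil-clear-< n A r k (pencil-nonneg (more e) A N (clear r (λ _ → true)))
    (pencil-positive e (minor r r A) (nonNegative-minor A r N)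
      (Unique.map⁻ {f = punchIn r} {xs = a ∷ b ∷ c ∷ d ∷ []} abcd!) 0<minor)

-- Edges of a bicyclic graph

length-filter : ∀ {A : Set} (f : A → Bool) xs →
  length (filter (λ x → f x ≟ᵇ true) xs) ≡ sumℕ (map (λ x → if f x then 1 else 0) xs)
length-filter f []       = refl
length-filter f (x ∷ xs) with f x
... | true  = cong suc (length-filter f xs)
... | false = length-filter f xs

sum-cartesianProduct : ∀ {A B : Set} (f : A × B → ℕ) xs ys →
  sumℕ (map f (cartesianProduct xs ys)) ≡ sumℕ (map (λ x → sumℕ (map (λ y → f (x , y)) ys)) xs)
sum-cartesianProduct f []       ys = refl
sum-cartesianProduct f (x ∷ xs) ys = begin
  sumℕ (map f (map (x ,_) ys ++ cartesianProduct xs ys))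
    ≡⟨ cong sumℕ (map-++ f (map (x ,_) ys) (cartesianProduct xs ys)) ⟩
  sumℕ (map f (map (x ,_) ys) ++ map f (cartesianProduct xs ys))
    ≡⟨ sum-++ (map f (map (x ,_) ys)) _ ⟩
  sumℕ (map f (map (x ,_) ys)) ℕ.+ sumℕ (map f (cartesianProduct xs ys))
    ≡⟨ cong₂ ℕ._+_ (cong sumℕ (sym (map-∘ ys))) (sum-cartesianProduct f xs ys) ⟩
  sumℕ (map (λ y → f (x , y)) ys) ℕ.+ sumℕ (map (λ x → sumℕ (map (λ y → f (x , y)) ys)) xs) ∎

pattern at₀ = here refl
pattern at₁ = there at₀
pattern at₂ = there at₁
pattern at₃ = there at₂
pattern at₄ = there at₃

module Edges {n : ℕ} (G : Graph n) where

  open DecMembership (_≟ᶠ_ {n}) using (_∈?_)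

  infix 4 _~_
  _~_ : Fin n → Fin n → Set
  x ~ y = adj G x y ≡ true

  _~?_ : ∀ x y → Dec (x ~ y)
  x ~? y = adj G x y ≟ᵇ true

  ~-sym : ∀ {x y} → x ~ y → y ~ x
  ~-sym {x} {y} x~y = trans (adj-sym G y x) x~y

  ~⇒≢ : ∀ {x y} → x ~ y → x ≢ y
  ~⇒≢ {x} x~x refl = case trans (sym x~x) (irrefl G x) of λ ()

  isEdge : Fin n × Fin n → Bool
  isEdge (i , j) = adj G i j ∧ (toℕ i <ᵇ toℕ j)

  edges : List (Fin n × Fin n)
  edges = filter (λ e → isEdge e ≟ᵇ true) (cartesianProduct (allFin n) (allFin n))

  length-edges : length edges ≡ edgeCount G
  length-edges = trans (length-filter isEdge (cartesianProduct (allFin n) (allFin n)))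
    (sum-cartesianProduct (λ e → if isEdge e then 1 else 0) (allFin n) (allFin n))

  -- the unordered pair {x, y}
  pair : Fin n → Fin n → Fin n × Fin n
  pair x y = if toℕ x <ᵇ toℕ y then (x , y) else (y , x)

  pair-< : ∀ {x y} → x Fin.< y → pair x y ≡ (x , y)
  pair-< {x} {y} x<y with toℕ x <ᵇ toℕ y | ℕₚ.<⇒<ᵇ x<y
  ... | true | _ = refl

  pair-> : ∀ {x y} → y Fin.< x → pair x y ≡ (y , x)
  pair-> {x} {y} y<x with toℕ x <ᵇ toℕ y in eq
  ... | false = refl
  ... | true  = contradiction (ℕₚ.<ᵇ⇒< (toℕ x) (toℕ y) (subst T (sym eq) tt)) (ℕₚ.<-asym y<x)

  pair-injective : ∀ {x y z w} → pair x y ≡ pair z w → (x ≡ z × y ≡ w) ⊎ (x ≡ w × y ≡ z)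
  pair-injective {x} {y} {z} {w} eq with toℕ x <ᵇ toℕ y | toℕ z <ᵇ toℕ w
  pair-injective refl | true  | true  = inj₁ (refl , refl)
  pair-injective refl | true  | false = inj₂ (refl , refl)
  pair-injective refl | false | true  = inj₂ (refl , refl)
  pair-injective refl | false | false = inj₁ (refl , refl)

  ∈-edges : ∀ {x y} → x ~ y → x Fin.< y → (x , y) ∈ edges
  ∈-edges {x} {y} x~y x<y = ∈-filter⁺ (λ e → isEdge e ≟ᵇ true)
    (∈-cartesianProduct⁺ (∈-allFin x) (∈-allFin y)) (cong₂ _∧_ x~y (T⇒≡true (ℕₚ.<⇒<ᵇ x<y)))
    where
    T⇒≡true : ∀ {b} → T b → b ≡ true
    T⇒≡true {true} _ = refl

  pair∈edges : ∀ {x y} → x ~ y → pair x y ∈ edges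
  pair∈edges {x} {y} x~y with <-cmp x y
  ... | tri< x<y _ _ = subst (_∈ edges) (sym (pair-< x<y)) (∈-edges x~y x<y)
  ... | tri≈ _ x≡y _ = contradiction x≡y (~⇒≢ x~y)
  ... | tri> _ _ y<x = subst (_∈ edges) (sym (pair-> y<x)) (∈-edges (~-sym x~y) y<x)

  ∈-edges⁻ : ∀ {x y} → (x , y) ∈ edges → x ~ y × x Fin.< y
  ∈-edges⁻ {x} {y} e∈ = split (adj G x y) (toℕ x <ᵇ toℕ y)
    (proj₂ (∈-filter⁻ (λ e → isEdge e ≟ᵇ true) {xs = cartesianProduct (allFin n) (allFin n)} e∈))
    (ℕₚ.<ᵇ⇒< (toℕ x) (toℕ y))
    where
    split : ∀ a b {P : Set} → a ∧ b ≡ true → (T b → P) → a ≡ true × P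
    split true true _ f = refl , f tt

  -- Dense S m certifies m edges in the subgraph induced on S, by adding its vertices one by one.
  data Dense : List (Fin n) → ℕ → Set where
    single : ∀ v → Dense [ v ] 0
    grow   : ∀ {S m y} xs → Dense S m → All (y ≢_) S → Unique xs → All (_∈ S) xs → All (y ~_) xs →
             Dense (y ∷ S) (length xs ℕ.+ m)

  dense-unique : ∀ {S m} → Dense S m → Unique S
  dense-unique (single v)           = [] ∷ []
  dense-unique (grow _ D y∉S _ _ _) = y∉S ∷ dense-unique D

  dense-inhabited : ∀ {S m} → Dense S m → ∃ (_∈ S)
  dense-inhabited (single v)            = v , here refl
  dense-inhabited (grow _ _ _ _ _ _)    = _ , here refl

  -- The last component keeps the induction going: a new vertex `y` lies outside `S`, so none of its
  -- edges is in the list already.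
  dense-edges : ∀ {S m} → Dense S m → ∃ λ L → Unique L × L ⊆ edges × length L ≡ m ×
    (∀ {x y} → pair x y ∈ L → x ∈ S)
  dense-edges (single v) = [] , [] , (λ ()) , refl , λ ()
  dense-edges {y ∷ S} (grow xs D y∉S xs! xs⊆S y~xs) with dense-edges D
  ... | L , L! , L⊆ , refl , L-in-S =
    map (pair y) xs ++ L
    , Unique.++⁺ (Unique.map⁺ pair-cancel xs!) L! disjoint
    , (λ e∈ → incl (∈-++⁻ (map (pair y) xs) e∈))
    , trans (length-++ (map (pair y) xs)) (cong (ℕ._+ length L) (length-map (pair y) xs))
    , λ e∈ → ends (∈-++⁻ (map (pair y) xs) e∈)
    where
    pair-cancel : ∀ {x z} → pair y x ≡ pair y z → x ≡ z
    pair-cancel eq with pair-injective eq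
    ... | inj₁ (_ , x≡z)     = x≡z
    ... | inj₂ (y≡z , x≡y)   = trans x≡y y≡z
    disjoint : ∀ {e} → ¬ (e ∈ map (pair y) xs × e ∈ L)
    disjoint (e∈xs , e∈L) with ∈-map⁻ (pair y) e∈xs
    ... | x , _ , refl = All.lookup y∉S (L-in-S e∈L) refl
    incl : ∀ {e} → e ∈ map (pair y) xs ⊎ e ∈ L → e ∈ edges
    incl (inj₂ e∈L) = L⊆ e∈L
    incl (inj₁ e∈xs) with ∈-map⁻ (pair y) e∈xs
    ... | x , x∈xs , refl = pair∈edges (All.lookup y~xs x∈xs)
    ends : ∀ {u v} → pair u v ∈ map (pair y) xs ⊎ pair u v ∈ L → u ∈ y ∷ S
    ends (inj₂ e∈L) = there (L-in-S e∈L)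
    ends (inj₁ e∈xs) with ∈-map⁻ (pair y) e∈xs
    ... | x , x∈xs , eq with pair-injective eq
    ...   | inj₁ (refl , _) = here refl
    ...   | inj₂ (refl , _) = there (All.lookup xs⊆S x∈xs)

  crossing : ∀ {S i j} → Walk G i j → i ∈ S → j ∉ S → ∃ λ x → ∃ λ y → x ∈ S × y ∉ S × x ~ y
  crossing here i∈S j∉S = contradiction i∈S j∉S
  crossing {S} (step {j = k} i~k w) i∈S j∉S with k ∈? S
  ... | yes k∈S = crossing w k∈S j∉S
  ... | no  k∉S = _ , k , i∈S , k∉S , i~k

  length-≤ : ∀ {S : List (Fin n)} → Unique S → length S ≤ n
  length-≤ {S} S! = subst (length S ≤_) (length-tabulate {n = n} (λ i → i))
    (unique-⊆-length S! (λ {v} _ → ∈-allFin v))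

  module _ (connected : Connected G) where

    outward : ∀ {S s} → s ∈ S → length S < n → ∃ λ x → ∃ λ y → x ∈ S × All (y ≢_) S × x ~ y
    outward {S} {s} s∈S short with fresh S short
    ... | v , v∉S with crossing (connected s v) s∈S v∉S
    ...   | x , y , x∈S , y∉S , x~y = x , y , x∈S , ¬Any⇒All¬ S y∉S , x~y

    -- Here `t` is the number of vertices outside `S`. Connectivity supplies an edge leaving `S`,
    -- whose outer end is added with this one edge, until all vertices are used.
    dense-extends : ∀ t {S m} → Dense S m → length S ℕ.+ t ≡ n → m ℕ.+ t ≤ edgeCount G
    dense-extends zero {S} {m} D eq with dense-edges D
    ... | L , L! , L⊆ , refl , _ = subst (_≤ edgeCount G) (sym (ℕₚ.+-identityʳ m))
      (subst (length L ≤_) length-edges (unique-⊆-length L! L⊆))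
    dense-extends (suc t) {S} {m} D eq
      with outward (proj₂ (dense-inhabited D))
             (subst (length S <_) eq (ℕₚ.m<m+n (length S) (s≤s z≤n)))
    ... | x , y , x∈S , y∉S , x~y = subst (_≤ edgeCount G) (sym (ℕₚ.+-suc m t))
      (dense-extends t (grow [ x ] D y∉S ([] ∷ []) (x∈S ∷ []) (~-sym x~y ∷ []))
        (trans (sym (ℕₚ.+-suc (length S) t)) eq))

  -- The two edges are opposite sides of a 4-cycle.
  Interlaced : (a b c d : Fin n) → Set
  Interlaced a b c d = (a ~ c × b ~ d) ⊎ (a ~ d × b ~ c)

  interlaced? : ∀ a b c d → Dec (Interlaced a b c d)
  interlaced? a b c d = ((a ~? c) ×-dec (b ~? d)) ⊎-dec ((a ~? d) ×-dec (b ~? c))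

  FreePair : (a b c d : Fin n) → Set
  FreePair a b c d = Unique (a ∷ b ∷ c ∷ d ∷ []) × a ~ b × c ~ d × ¬ Interlaced a b c d

  record Cycle₄ (v₁ v₂ v₃ v₄ : Fin n) : Set where
    constructor cycle₄
    field
      distinct : Unique (v₁ ∷ v₂ ∷ v₃ ∷ v₄ ∷ [])
      v₁~v₂    : v₁ ~ v₂
      v₂~v₃    : v₂ ~ v₃
      v₃~v₄    : v₃ ~ v₄
      v₄~v₁    : v₄ ~ v₁

  rotate : ∀ {v₁ v₂ v₃ v₄} → Cycle₄ v₁ v₂ v₃ v₄ → Cycle₄ v₂ v₃ v₄ v₁
  rotate (cycle₄ ((v₁≢v₂ ∷ v₁≢v₃ ∷ v₁≢v₄ ∷ []) ∷ (v₂≢v₃ ∷ v₂≢v₄ ∷ []) ∷ (v₃≢v₄ ∷ []) ∷ _) e₁₂ e₂₃ e₃₄ e₄₁) =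
    cycle₄ ((v₂≢v₃ ∷ v₂≢v₄ ∷ ≢-sym v₁≢v₂ ∷ []) ∷ (v₃≢v₄ ∷ ≢-sym v₁≢v₃ ∷ []) ∷ (≢-sym v₁≢v₄ ∷ []) ∷ [] ∷ [])
      e₂₃ e₃₄ e₄₁ e₁₂

  -- Sparsity of bicyclic graphs and disjoint edges.

  module _ (bicyclic : Bicyclic G) where

    dense-bound : ∀ {S m} → Dense S m → m ≤ suc (length S)
    dense-bound {S} {m} D = ℕₚ.+-cancelʳ-≤ t m (suc (length S))
      (subst (m ℕ.+ t ≤_) (trans (proj₂ bicyclic) (cong suc (sym size)))
        (dense-extends (proj₁ bicyclic) t D size))
      where
      t = n ℕ.∸ length S
      size : length S ℕ.+ t ≡ n
      size = ℕₚ.m+[n∸m]≡n (length-≤ (dense-unique D))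

    -- Otherwise all n + 1 edges would belong to the star of `a`, which is covered by a list of
    -- length n.
    edge-avoiding : ∀ a → ∃ λ x → ∃ λ y → x ≢ a × y ≢ a × x ~ y
    edge-avoiding a with any? (λ x → any? λ y → ¬? (x ≟ᶠ a) ×-dec (¬? (y ≟ᶠ a) ×-dec (x ~? y)))
    ... | yes found = found
    ... | no  none  = contradiction
      (ℕₚ.≤-trans (ℕₚ.≤-reflexive (sym (trans length-edges (proj₂ bicyclic)))) bound) ℕₚ.1+n≰n
      where
      star : edges ⊆ map (pair a) (allFin n)
      star {x , y} e∈ with ∈-edges⁻ e∈ | x ≟ᶠ a | y ≟ᶠ a
      ... | x~y , x<y | yes refl | _        =
        subst (_∈ map (pair a) (allFin n)) (pair-< x<y) (∈-map⁺ (pair a) (∈-allFin y))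
      ... | x~y , x<y | no _     | yes refl =
        subst (_∈ map (pair a) (allFin n)) (pair-> x<y) (∈-map⁺ (pair a) (∈-allFin x))
      ... | x~y , x<y | no x≢a   | no y≢a   = contradiction (x , y , x≢a , y≢a , x~y) none
      bound : length edges ≤ n
      bound = subst (length edges ≤_) (trans (length-map (pair a) (allFin n)) (length-tabulate {n = n} (λ i → i)))
        (unique-⊆-length (Unique.filter⁺ (λ e → isEdge e ≟ᵇ true)
          (Unique.cartesianProduct⁺ (Unique.allFin⁺ n) (Unique.allFin⁺ n))) star)

    -- Six edges on four vertices exceed the bound of five.
    no-K₄ : ∀ {a b c d} → Unique (a ∷ b ∷ c ∷ d ∷ []) →
      a ~ b → a ~ c → a ~ d → b ~ c → b ~ d → ¬ c ~ d
    no-K₄ {a} {b} {c} {d} (a∉ ∷ b∉@((b≢c ∷ b≢d ∷ [])) ∷ c∉ ∷ d∉ ∷ []) ab ac ad bc bd cd =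
      contradiction (dense-bound D₄) (λ { (s≤s (s≤s (s≤s (s≤s (s≤s ()))))) })
      where
      D₂ : Dense (c ∷ d ∷ []) 1
      D₂ = grow (d ∷ []) (single d) c∉ (d∉ ∷ []) (at₀ ∷ []) (cd ∷ [])
      D₃ : Dense (b ∷ c ∷ d ∷ []) 3
      D₃ = grow (c ∷ d ∷ []) D₂ b∉ (c∉ ∷ d∉ ∷ []) (at₀ ∷ at₁ ∷ []) (bc ∷ bd ∷ [])
      D₄ : Dense (a ∷ b ∷ c ∷ d ∷ []) 6
      D₄ = grow (b ∷ c ∷ d ∷ []) D₃ a∉ (b∉ ∷ c∉ ∷ d∉ ∷ []) (at₀ ∷ at₁ ∷ at₂ ∷ []) (ab ∷ ac ∷ ad ∷ [])

    DisjointEdges : Set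
    DisjointEdges = ∃ λ a → ∃ λ b → ∃ λ c → ∃ λ d → Unique (a ∷ b ∷ c ∷ d ∷ []) × a ~ b × c ~ d

    module _ (4≤n : 4 ≤ n) where

      -- Some edge leaves the triangle, and it is disjoint from the side opposite to its inner end.
      triangle-disjoint : ∀ {a b c} → a ~ b → b ~ c → a ~ c → DisjointEdges
      triangle-disjoint {a} {b} {c} ab bc ac with outward (proj₁ bicyclic) {a ∷ b ∷ c ∷ []} at₀ 4≤n
      ... | x , y , x∈ , (y≢a ∷ y≢b ∷ y≢c ∷ []) , x~y = cases x∈
        where
        cases : x ∈ a ∷ b ∷ c ∷ [] → DisjointEdges
        cases at₀ = a , y , b , c ,
          ((≢-sym y≢a ∷ ~⇒≢ ab ∷ ~⇒≢ ac ∷ []) ∷ (y≢b ∷ y≢c ∷ []) ∷ (~⇒≢ bc ∷ []) ∷ [] ∷ []) , x~y , bc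
        cases at₁ = b , y , a , c ,
          ((≢-sym y≢b ∷ ≢-sym (~⇒≢ ab) ∷ ~⇒≢ bc ∷ []) ∷ (y≢a ∷ y≢c ∷ []) ∷ (~⇒≢ ac ∷ []) ∷ [] ∷ []) , x~y , ac
        cases at₂ = c , y , a , b ,
          ((≢-sym y≢c ∷ ≢-sym (~⇒≢ ac) ∷ ≢-sym (~⇒≢ bc) ∷ []) ∷ (y≢a ∷ y≢b ∷ []) ∷ (~⇒≢ ab ∷ []) ∷ [] ∷ []) , x~y , ab

      path₄-disjoint : ∀ {a b c d} → a ~ b → b ~ c → a ≢ c → a ~ d → d ≢ b → DisjointEdges
      path₄-disjoint {a} {b} {c} {d} ab bc a≢c ad d≢b with d ≟ᶠ c
      ... | yes refl = triangle-disjoint ab bc ad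
      ... | no  d≢c  = a , d , b , c ,
        ((~⇒≢ ad ∷ ~⇒≢ ab ∷ a≢c ∷ []) ∷ (d≢b ∷ d≢c ∷ []) ∷ (~⇒≢ bc ∷ []) ∷ [] ∷ []) , ad , bc

      -- An edge avoiding the middle vertex `b` either misses `a`, hence is disjoint from ab, or
      -- prolongs the path at `a`. In the latter case its end edges are disjoint unless it closes to
      -- a triangle.
      path₃-disjoint : ∀ {a b c} → a ~ b → b ~ c → a ≢ c → DisjointEdges
      path₃-disjoint {a} {b} {c} ab bc a≢c with edge-avoiding b
      ... | x , y , x≢b , y≢b , xy with a ≟ᶠ x | a ≟ᶠ y
      ...   | yes refl | _        = path₄-disjoint ab bc a≢c xy y≢b
      ...   | no _     | yes refl = path₄-disjoint ab bc a≢c (~-sym xy) x≢b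
      ...   | no a≢x   | no a≢y   = a , b , x , y ,
        ((~⇒≢ ab ∷ a≢x ∷ a≢y ∷ []) ∷ (≢-sym x≢b ∷ ≢-sym y≢b ∷ []) ∷ (~⇒≢ xy ∷ []) ∷ [] ∷ []) , ab , xy

      disjointEdges : DisjointEdges
      -- The vertex avoided here is arbitrary; only some edge ab is wanted.
      disjointEdges with edge-avoiding (fromℕ< (ℕₚ.≤-trans (s≤s z≤n) 4≤n))
      ... | a , b , _ , _ , ab with edge-avoiding a
      ...   | x , y , x≢a , y≢a , xy with b ≟ᶠ x | b ≟ᶠ y
      ...     | yes refl | _        = path₃-disjoint ab xy (≢-sym y≢a)
      ...     | no _     | yes refl = path₃-disjoint ab (~-sym xy) (≢-sym x≢a)
      ...     | no b≢x   | no b≢y   = a , b , x , y ,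
        ((~⇒≢ ab ∷ ≢-sym x≢a ∷ ≢-sym y≢a ∷ []) ∷ (b≢x ∷ b≢y ∷ []) ∷ (~⇒≢ xy ∷ []) ∷ [] ∷ []) , ab , xy

    -- Contradiction from the assumption that all disjoint edges are interlaced.

    module _ (6≤n : 6 ≤ n)
      (interlaced : ∀ {a b c d} → Unique (a ∷ b ∷ c ∷ d ∷ []) → a ~ b → c ~ d → Interlaced a b c d)
      where

      some-cycle₄ : ∃ λ v₁ → ∃ λ v₂ → ∃ λ v₃ → ∃ λ v₄ → Cycle₄ v₁ v₂ v₃ v₄
      some-cycle₄ with disjointEdges (ℕₚ.≤-trans (s≤s (s≤s (s≤s (s≤s z≤n)))) 6≤n)
      ... | a , b , c , d , abcd!@((a≢b ∷ a≢c ∷ a≢d ∷ []) ∷ (b≢c ∷ b≢d ∷ []) ∷ (c≢d ∷ []) ∷ _) , ab , cd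
        with interlaced abcd! ab cd
      ...   | inj₂ (ad , bc) = a , b , c , d , cycle₄ abcd! ab bc cd (~-sym ad)
      ...   | inj₁ (ac , bd) = a , b , d , c , cycle₄
        ((a≢b ∷ a≢d ∷ a≢c ∷ []) ∷ (b≢d ∷ b≢c ∷ []) ∷ (≢-sym c≢d ∷ []) ∷ [] ∷ []) ab bd (~-sym cd) (~-sym ac)

      -- Otherwise y, v₁, …, v₄ would span 8 edges.
      opposite-neighbour : ∀ {v₁ v₂ v₃ v₄ y} → Cycle₄ v₁ v₂ v₃ v₄ → All (y ≢_) (v₁ ∷ v₂ ∷ v₃ ∷ v₄ ∷ []) →
        y ~ v₁ → y ~ v₃
      opposite-neighbour {v₁} {v₂} {v₃} {v₄} {y}
        (cycle₄ (v₁∉@(v₁≢v₂ ∷ v₁≢v₃ ∷ v₁≢v₄ ∷ []) ∷ v₂∉@(v₂≢v₃ ∷ v₂≢v₄ ∷ []) ∷ v₃∉@(v₃≢v₄ ∷ []) ∷ v₄∉ ∷ []) e₁₂ e₂₃ e₃₄ e₄₁)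
        y∉@(y≢v₁ ∷ y≢v₂ ∷ y≢v₃ ∷ y≢v₄ ∷ []) yv₁
        with interlaced ((y≢v₁ ∷ y≢v₂ ∷ y≢v₃ ∷ []) ∷ (v₁≢v₂ ∷ v₁≢v₃ ∷ []) ∷ (v₂≢v₃ ∷ []) ∷ [] ∷ []) yv₁ e₂₃
           | interlaced ((y≢v₁ ∷ y≢v₄ ∷ y≢v₃ ∷ []) ∷ (v₁≢v₄ ∷ v₁≢v₃ ∷ []) ∷ (≢-sym v₃≢v₄ ∷ []) ∷ [] ∷ []) yv₁ (~-sym e₃₄)
      ... | inj₂ (yv₃ , _)   | _                = yv₃
      ... | inj₁ _           | inj₂ (yv₃ , _)   = yv₃
      ... | inj₁ (yv₂ , e₁₃) | inj₁ (yv₄ , _)   =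
        contradiction (dense-bound D₅) (λ { (s≤s (s≤s (s≤s (s≤s (s≤s (s≤s ())))))) })
        where
        D₂ : Dense (v₃ ∷ v₄ ∷ []) 1
        D₂ = grow (v₄ ∷ []) (single v₄) v₃∉ (v₄∉ ∷ []) (at₀ ∷ []) (e₃₄ ∷ [])
        D₃ : Dense (v₂ ∷ v₃ ∷ v₄ ∷ []) 2
        D₃ = grow (v₃ ∷ []) D₂ v₂∉ ([] ∷ []) (at₀ ∷ []) (e₂₃ ∷ [])
        D₄ : Dense (v₁ ∷ v₂ ∷ v₃ ∷ v₄ ∷ []) 5
        D₄ = grow (v₂ ∷ v₃ ∷ v₄ ∷ []) D₃ v₁∉ (v₂∉ ∷ v₃∉ ∷ v₄∉ ∷ []) (at₀ ∷ at₁ ∷ at₂ ∷ []) (e₁₂ ∷ e₁₃ ∷ ~-sym e₄₁ ∷ [])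
        D₅ : Dense (y ∷ v₁ ∷ v₂ ∷ v₃ ∷ v₄ ∷ []) 8
        D₅ = grow (v₁ ∷ v₂ ∷ v₄ ∷ []) D₄ y∉ ((v₁≢v₂ ∷ v₁≢v₄ ∷ []) ∷ (v₂≢v₄ ∷ []) ∷ v₄∉ ∷ [])
               (at₀ ∷ at₁ ∷ at₃ ∷ []) (yv₁ ∷ yv₂ ∷ yv₄ ∷ [])

      -- y completes the cycle to K₂,₃ with 6 edges; a sixth vertex would bring two more.
      no-neighbour : ∀ {v₁ v₂ v₃ v₄ y} → Cycle₄ v₁ v₂ v₃ v₄ → All (y ≢_) (v₁ ∷ v₂ ∷ v₃ ∷ v₄ ∷ []) →
        ¬ y ~ v₁
      no-neighbour {v₁} {v₂} {v₃} {v₄} {y}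
        C@(cycle₄ (v₁∉@(v₁≢v₂ ∷ v₁≢v₃ ∷ v₁≢v₄ ∷ []) ∷ v₂∉@(v₂≢v₃ ∷ v₂≢v₄ ∷ []) ∷ v₃∉@(v₃≢v₄ ∷ []) ∷ v₄∉ ∷ []) e₁₂ e₂₃ e₃₄ e₄₁)
        y∉@(y≢v₁ ∷ y≢v₂ ∷ y≢v₃ ∷ y≢v₄ ∷ []) yv₁
        with outward (proj₁ bicyclic) {y ∷ v₁ ∷ v₂ ∷ v₃ ∷ v₄ ∷ []} at₀ 6≤n
      ... | x , z , x∈ , z∉@(z≢y ∷ z≢v₁ ∷ z≢v₂ ∷ z≢v₃ ∷ z≢v₄ ∷ []) , xz = cases x∈
        where
        yv₃ = opposite-neighbour C y∉ yv₁
        zx  = ~-sym xz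
        D₂ : Dense (v₃ ∷ v₄ ∷ []) 1
        D₂ = grow (v₄ ∷ []) (single v₄) v₃∉ (v₄∉ ∷ []) (at₀ ∷ []) (e₃₄ ∷ [])
        D₃ : Dense (v₂ ∷ v₃ ∷ v₄ ∷ []) 2
        D₃ = grow (v₃ ∷ []) D₂ v₂∉ ([] ∷ []) (at₀ ∷ []) (e₂₃ ∷ [])
        D₄ : Dense (v₁ ∷ v₂ ∷ v₃ ∷ v₄ ∷ []) 4
        D₄ = grow (v₂ ∷ v₄ ∷ []) D₃ v₁∉ ((v₂≢v₄ ∷ []) ∷ v₄∉ ∷ []) (at₀ ∷ at₂ ∷ []) (e₁₂ ∷ ~-sym e₄₁ ∷ [])
        D₅ : Dense (y ∷ v₁ ∷ v₂ ∷ v₃ ∷ v₄ ∷ []) 6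
        D₅ = grow (v₁ ∷ v₃ ∷ []) D₄ y∉ ((v₁≢v₃ ∷ []) ∷ [] ∷ []) (at₀ ∷ at₂ ∷ []) (yv₁ ∷ yv₃ ∷ [])
        -- A second 4-cycle of the K₂,₃. It serves the case in which the sixth vertex `z` is
        -- adjacent to `y`, whose opposite on this cycle is v₂.
        C′ : Cycle₄ y v₁ v₂ v₃
        C′ = cycle₄ ((y≢v₁ ∷ y≢v₂ ∷ y≢v₃ ∷ []) ∷ (v₁≢v₂ ∷ v₁≢v₃ ∷ []) ∷ (v₂≢v₃ ∷ []) ∷ [] ∷ [])
               yv₁ e₁₂ e₂₃ (~-sym yv₃)
        two-neighbours : ∀ {u w} → u ≢ w → u ∈ y ∷ v₁ ∷ v₂ ∷ v₃ ∷ v₄ ∷ [] → w ∈ y ∷ v₁ ∷ v₂ ∷ v₃ ∷ v₄ ∷ [] →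
          z ~ u → z ~ w → ⊥
        two-neighbours {u} {w} u≢w u∈ w∈ zu zw = contradiction
          (dense-bound (grow (u ∷ w ∷ []) D₅ z∉ ((u≢w ∷ []) ∷ [] ∷ []) (u∈ ∷ w∈ ∷ []) (zu ∷ zw ∷ [])))
          (λ { (s≤s (s≤s (s≤s (s≤s (s≤s (s≤s (s≤s ()))))))) })
        cases : x ∈ y ∷ v₁ ∷ v₂ ∷ v₃ ∷ v₄ ∷ [] → ⊥
        cases at₀ = two-neighbours y≢v₂ at₀ at₂ zx
          (opposite-neighbour C′ (z≢y ∷ z≢v₁ ∷ z≢v₂ ∷ z≢v₃ ∷ []) zx)
        cases at₁ = two-neighbours v₁≢v₃ at₁ at₃ zx
          (opposite-neighbour C (z≢v₁ ∷ z≢v₂ ∷ z≢v₃ ∷ z≢v₄ ∷ []) zx)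
        cases at₂ = two-neighbours v₂≢v₄ at₂ at₄ zx
          (opposite-neighbour (rotate C) (z≢v₂ ∷ z≢v₃ ∷ z≢v₄ ∷ z≢v₁ ∷ []) zx)
        cases at₃ = two-neighbours (≢-sym v₁≢v₃) at₃ at₁ zx
          (opposite-neighbour (rotate (rotate C)) (z≢v₃ ∷ z≢v₄ ∷ z≢v₁ ∷ z≢v₂ ∷ []) zx)
        cases at₄ = two-neighbours (≢-sym v₂≢v₄) at₄ at₂ zx
          (opposite-neighbour (rotate (rotate (rotate C))) (z≢v₄ ∷ z≢v₁ ∷ z≢v₂ ∷ z≢v₃ ∷ []) zx)

      -- With more than four vertices some edge leaves the 4-cycle; a rotation moves its inner end
      -- to the first place, where `no-neighbour` applies.
      not-all-interlaced : ⊥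
      not-all-interlaced with some-cycle₄
      ... | v₁ , v₂ , v₃ , v₄ , C with outward (proj₁ bicyclic) {v₁ ∷ v₂ ∷ v₃ ∷ v₄ ∷ []} at₀ (ℕₚ.<⇒≤ 6≤n)
      ...   | x , y , x∈ , (y≢v₁ ∷ y≢v₂ ∷ y≢v₃ ∷ y≢v₄ ∷ []) , xy = cases x∈
        where
        cases : x ∈ v₁ ∷ v₂ ∷ v₃ ∷ v₄ ∷ [] → ⊥
        cases at₀ = no-neighbour C (y≢v₁ ∷ y≢v₂ ∷ y≢v₃ ∷ y≢v₄ ∷ []) (~-sym xy)
        cases at₁ = no-neighbour (rotate C) (y≢v₂ ∷ y≢v₃ ∷ y≢v₄ ∷ y≢v₁ ∷ []) (~-sym xy)
        cases at₂ = no-neighbour (rotate (rotate C)) (y≢v₃ ∷ y≢v₄ ∷ y≢v₁ ∷ y≢v₂ ∷ []) (~-sym xy)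
        cases at₃ = no-neighbour (rotate (rotate (rotate C))) (y≢v₄ ∷ y≢v₁ ∷ y≢v₂ ∷ y≢v₃ ∷ []) (~-sym xy)

    -- Existence comes from a finite search, whose failure is exactly the assumption refuted above.
    freePair : 6 ≤ n → ∃ λ a → ∃ λ b → ∃ λ c → ∃ λ d → FreePair a b c d
    freePair 6≤n with any? (λ a → any? λ b → any? λ c → any? λ d →
      unique? _≟ᶠ_ (a ∷ b ∷ c ∷ d ∷ []) ×-dec ((a ~? b) ×-dec ((c ~? d) ×-dec ¬? (interlaced? a b c d))))
    ... | yes found = found
    ... | no  none  = ⊥-elim (not-all-interlaced 6≤n λ {a} {b} {c} {d} abcd! ab cd →
      decidable-stable (interlaced? a b c d) λ free → none (a , b , c , d , abcd! , ab , cd , free))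

  -- Minors of the signed adjacency matrix and the upper bound.

  -- The constant part of the pencil x I - A.
  negated : Signature G → Matrix n
  negated s i j = - adjMatrix G s i j

  entry-0 : ∀ s {i j} → ¬ i ~ j → negated s i j ≡ 0ℤ
  entry-0 s {i} {j} i≁j with adj G i j
  ... | true  = contradiction refl i≁j
  ... | false = refl

  entry-unit : ∀ s {i j} → i ~ j → negated s i j * negated s i j ≡ 1ℤ
  entry-unit s {i} {j} i~j rewrite i~j with σ s i j
  ... | Sign.+ = refl
  ... | Sign.- = refl

  negated-hollow : ∀ s → Hollow (negated s)
  negated-hollow s = record
    { symmetric = λ i j → cong₂ (λ b t → - (if b then signℤ t else 0ℤ)) (adj-sym G i j) (σsym s i j)
    ; diagonal  = λ i → entry-0 s (λ i~i → ~⇒≢ i~i refl)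
    }

  product-0 : ∀ s {a b c d} → ¬ (a ~ b × c ~ d) → negated s a b * negated s c d ≡ 0ℤ
  product-0 s {a} {b} {c} {d} not-both with a ~? b
  ... | no  ab = cong (_* negated s c d) (entry-0 s ab)
  ... | yes ab = trans (cong (negated s a b *_) (entry-0 s (λ cd → not-both (ab , cd)))) (*-zeroʳ (negated s a b))

  negated-nonNegative : Bicyclic G → ∀ s → NonNegative (negated s)
  negated-nonNegative bicyclic s = record { hollow = negated-hollow s ; minors = λ {a} {b} {c} {d} → minors′ a b c d }
    where
    M = negated s
    minors′ : ∀ a b c d → Unique (a ∷ b ∷ c ∷ d ∷ []) → 0ℤ ℤ.≤ minor₄ M a b c d
    minors′ a b c d abcd!
      with (a ~? b) ×-dec (c ~? d) | (a ~? c) ×-dec (b ~? d) | (a ~? d) ×-dec (b ~? c)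
    ... | no ¬p | _ | _ = quadratic-p≡0 (M a c * M b d) (M a d * M b c) (product-0 s ¬p)
    ... | yes _ | no ¬q | _ = quadratic-q≡0 (M a b * M c d) (M a d * M b c) (product-0 s ¬q)
    ... | yes _ | yes _ | no ¬r = quadratic-r≡0 (M a b * M c d) (M a c * M b d) (product-0 s ¬r)
    ... | yes (ab , cd) | yes (ac , bd) | yes (ad , bc) = contradiction cd (no-K₄ bicyclic abcd! ab ac ad bc bd)

  -- Since the edges are not interlaced, the other two matching products are 0 and the minor is p²,
  -- where p is a product of two entries 1 or -1.
  freePair-minor₄ : ∀ s {a b c d} → FreePair a b c d →
    0ℤ ℤ.< minor₄ (negated s) a b c d
  freePair-minor₄ s {a} {b} {c} {d} (_ , ab , cd , free) = subst (0ℤ ℤ.<_) (sym value) (ℤ.+<+ (s≤s z≤n))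
    where
    M = negated s
    p = M a b * M c d
    square : ∀ x y → x * y * (x * y) + 0ℤ * 0ℤ + 0ℤ * 0ℤ
      - (x * y * 0ℤ + x * y * 0ℤ + 0ℤ * 0ℤ) - (x * y * 0ℤ + x * y * 0ℤ + 0ℤ * 0ℤ) ≡ x * x * (y * y)
    square = solve-∀
    value : minor₄ M a b c d ≡ 1ℤ
    value = begin
      quadratic p (M a c * M b d) (M a d * M b c)
        ≡⟨ cong₂ (quadratic p) (product-0 s (free ∘ inj₁)) (product-0 s (free ∘ inj₂)) ⟩
      quadratic p 0ℤ 0ℤ                             ≡⟨ square (M a b) (M c d) ⟩
      M a b * M a b * (M c d * M c d)               ≡⟨ cong₂ _*_ (entry-unit s ab) (entry-unit s cd) ⟩
      1ℤ                                            ∎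

  -- The free pair makes one minor positive and no minor is negative, so the coefficient at index n
  -- - 4 is positive and `mult0` cannot count past it.
  η-≤ : Bicyclic G → 6 ≤ n → ∀ s → η G s ≤ n ℕ.∸ 4
  η-≤ bicyclic 6≤n s with freePair bicyclic 6≤n
  ... | a , b , c , d , free = mult0-≤ (charPoly n (adjMatrix G s)) (n ℕ.∸ 4)
    (λ p≡0 → ℤₚ.<-irrefl (trans (sym p≡0) (coeff-charPoly (adjMatrix G s) (n ℕ.∸ 4)))
      (pencil-positive fours (negated s) (negated-nonNegative bicyclic s) (proj₁ free)
        (freePair-minor₄ s free)))
    where
    fours : FourMore n (n ℕ.∸ 4)
    fours = subst (λ m → FourMore m (n ℕ.∸ 4))
      (ℕₚ.m+[n∸m]≡n (ℕₚ.≤-trans (ℕₚ.m≤m+n 4 2) 6≤n)) (fourMore (n ℕ.∸ 4))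

theorem5p9 : (n : ℕ) → 8 ≤ n → (k : ℕ) →
    (Σ (Graph n) (λ G → Bicyclic G × Σ (Signature G) (λ s → η G s ≡ k))) ⇔ (k ≤ n ∸ 4)
theorem5p9 n 8≤n k = mk⇔
  (λ { (G , bicyclic , s , refl) → Edges.η-≤ G bicyclic (ℕₚ.≤-trans (ℕₚ.m≤m+n 6 2) 8≤n) s })
  (realizable n k (ℕₚ.≤-trans (ℕₚ.m≤m+n 4 4) 8≤n))
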